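{- (Cut-elimination.) Consider the rule $(cut)$: from $\mathcal{G}/\!/\Gamma\vdash\Delta,A/\!/\mathcal{H}$ and $\mathcal{F}/\!/A^{k_1},\Gamma_1\vdash\Delta_1/\!/\cdots/\!/A^{k_n},\Gamma_n\vdash\Delta_n$ infer $$(\mathcal{G}\oplus\mathcal{F})/\!/\Gamma,\Gamma_1\vdash\Delta,\Delta_1/\!/\big(\mathcal{H}\oplus(\Gamma_2\vdash\Delta_2/\!/\cdots/\!/\Gamma_n\vdash\Delta_n)\big),$$ where $\mathcal{G}$ and $\mathcal{F}$ have the same number of components, $\mathcal{H}$ has $n-1$ components, and $\sum_{i=1}^n k_i\ge 1$. Then $(cut)$ is eliminable in $\mathsf{LNIF}$: every linear nested sequent derivable in $\mathsf{LNIF}$ extended with $(cut)$ is derivable in $\mathsf{LNIF}$.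
   Context: $A^{k}$ denotes $k$ copies of the formula $A$. The splice $\oplus$ of two sequences of components is defined by: $(\Gamma_1\vdash\Delta_1)\oplus(\Gamma_2\vdash\Delta_2)=\Gamma_1,\Gamma_2\vdash\Delta_1,\Delta_2$; $(\Gamma_1\vdash\Delta_1)\oplus(\Gamma_2\vdash\Delta_2/\!/\mathcal{F})=\Gamma_1,\Gamma_2\vdash\Delta_1,\Delta_2/\!/\mathcal{F}$; $(\Gamma_1\vdash\Delta_1/\!/\mathcal{F})\oplus(\Gamma_2\vdash\Delta_2)=\Gamma_1,\Gamma_2\vdash\Delta_1,\Delta_2/\!/\mathcal{F}$; $(\Gamma_1\vdash\Delta_1/\!/\mathcal{F})\oplus(\Gamma_2\vdash\Delta_2/\!/\mathcal{K})=\Gamma_1,\Gamma_2\vdash\Delta_1,\Delta_2/\!/(\mathcal{F}\oplus\mathcal{K})$ (the splice of two empty sequences is empty). Formulae are first-order over $\bot,\land,\lor,\supset,\forall,\exists$; in sequents bound variables $x,y,\dots$ are distinct from parameters $a,b,\dots$, which occupy all free positions; $A[a/x]$ replaces free occurrences of $x$ by $a$; $p(\vec a)$ is an atomic formula with parameters $\vec a$. A linear nested sequent is $\Gamma_1\vdash\Delta_1 /\!/ \cdots /\!/ \Gamma_n\vdash\Delta_n$ ($n\ge1$), each $\Gamma_i,\Delta_i$ a finite, possibly empty, multiset of formulae (a component). In rule schemas, $\mathcal{G},\mathcal{H},\mathcal{F}$ denote possibly empty sequences of components. $\mathsf{LNIF}$ has the rules (from premise(s) infer conclusion): Initial: $(id_1)$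 $\mathcal{G}/\!/\Gamma,p(\vec a)\vdash p(\vec a),\Delta/\!/\mathcal{H}$; $(id_2)$ $\mathcal{G}/\!/\Gamma_1,p(\vec a)\vdash\Delta_1/\!/\mathcal{H}/\!/\Gamma_2\vdash p(\vec a),\Delta_2/\!/\mathcal{F}$; $(\bot_l)$ $\mathcal{G}/\!/\Gamma,\bot\vdash\Delta/\!/\mathcal{H}$. $(\land_l)$: from $\mathcal{G}/\!/\Gamma,A,B\vdash\Delta/\!/\mathcal{H}$ infer $\mathcal{G}/\!/\Gamma,A\land B\vdash\Delta/\!/\mathcal{H}$. $(\lor_r)$: from $\mathcal{G}/\!/\Gamma\vdash\Delta,A,B/\!/\mathcal{H}$ infer $\mathcal{G}/\!/\Gamma\vdash\Delta,A\lor B/\!/\mathcal{H}$. $(\land_r)$: from $\mathcal{G}/\!/\Gamma\vdash\Delta,A/\!/\mathcal{H}$ and $\mathcal{G}/\!/\Gamma\vdash\Delta,B/\!/\mathcal{H}$ infer $\mathcal{G}/\!/\Gamma\vdash\Delta,A\land B/\!/\mathcal{H}$. $(\lor_l)$: from $\mathcal{G}/\!/\Gamma,A\vdash\Delta/\!/\mathcal{H}$ and $\mathcal{G}/\!/\Gamma,B\vdash\Delta/\!/\mathcal{H}$ infer $\mathcal{G}/\!/\Gamma,A\lor B\vdash\Delta/\!/\mathcal{H}$. $(\supset_{r1})$: from $\mathcal{G}/\!/\Gamma\vdash\Delta/\!/A\vdash B$ infer $\mathcal{G}/\!/\Gamma\vdash\Delta,A\supset B$. $(\supset_l)$: from $\mathcal{G}/\!/\Gamma,B\vdash\Delta/\!/\mathcal{H}$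 and $\mathcal{G}/\!/\Gamma,A\supset B\vdash A,\Delta/\!/\mathcal{H}$ infer $\mathcal{G}/\!/\Gamma,A\supset B\vdash\Delta/\!/\mathcal{H}$. $(lift)$: from $\mathcal{G}/\!/\Gamma_1,A\vdash\Delta_1/\!/\Gamma_2,A\vdash\Delta_2/\!/\mathcal{H}$ infer $\mathcal{G}/\!/\Gamma_1,A\vdash\Delta_1/\!/\Gamma_2\vdash\Delta_2/\!/\mathcal{H}$. $(\forall_l)$: from $\mathcal{G}/\!/\Gamma,A[a/x],\forall xA\vdash\Delta/\!/\mathcal{H}$ infer $\mathcal{G}/\!/\Gamma,\forall xA\vdash\Delta/\!/\mathcal{H}$ ($a$ any parameter). $(\forall_{r1})$: from $\mathcal{G}/\!/\Gamma\vdash\Delta/\!/\ \vdash A[a/x]$ infer $\mathcal{G}/\!/\Gamma\vdash\Delta,\forall xA$. $(\exists_l)$: from $\mathcal{G}/\!/\Gamma,A[a/x]\vdash\Delta/\!/\mathcal{H}$ infer $\mathcal{G}/\!/\Gamma,\exists xA\vdash\Delta/\!/\mathcal{H}$. $(\exists_r)$: from $\mathcal{G}/\!/\Gamma\vdash A[a/x],\exists xA,\Delta/\!/\mathcal{H}$ infer $\mathcal{G}/\!/\Gamma\vdash\exists xA,\Delta/\!/\mathcal{H}$ ($a$ any parameter). $(\supset_{r2})$: from $\mathcal{G}/\!/\Gamma_1\vdash\Delta_1/\!/A\vdash B/\!/\Gamma_2\vdash\Delta_2/\!/\mathcal{H}$ and $\mathcal{G}/\!/\Gamma_1\vdash\Delta_1/\!/\Gamma_2\vdash\Delta_2,A\supset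 B/\!/\mathcal{H}$ infer $\mathcal{G}/\!/\Gamma_1\vdash\Delta_1,A\supset B/\!/\Gamma_2\vdash\Delta_2/\!/\mathcal{H}$. $(\forall_{r2})$: from $\mathcal{G}/\!/\Gamma_1\vdash\Delta_1/\!/\ \vdash A[a/x]/\!/\Gamma_2\vdash\Delta_2/\!/\mathcal{H}$ and $\mathcal{G}/\!/\Gamma_1\vdash\Delta_1/\!/\Gamma_2\vdash\Delta_2,\forall xA/\!/\mathcal{H}$ infer $\mathcal{G}/\!/\Gamma_1\vdash\Delta_1,\forall xA/\!/\Gamma_2\vdash\Delta_2/\!/\mathcal{H}$. In $(\forall_{r1}),(\exists_l),(\forall_{r2})$, $a$ is an eigenvariable (does not occur in the conclusion). -}

module Defs where

open import Data.Nat using (ℕ; _≟_; _+_; _≤_)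
open import Data.Bool using (Bool; true; false; if_then_else_)
open import Data.List using (List; []; _∷_; _++_; replicate; map; zipWith; length; concatMap)
open import Data.Nat.ListAction using (sum)
open import Data.Unit using (⊤)
open import Data.List.Relation.Binary.Permutation.Propositional using (_↭_)
open import Data.List.Relation.Binary.Pointwise using (Pointwise)
open import Data.List.Membership.Propositional using (_∈_; _∉_)
open import Data.List.Relation.Unary.All using (All)
open import Data.Product using (_×_; _,_; proj₁; proj₂)
open import Relation.Binary.PropositionalEquality using (_≡_)
open import Relation.Nullary using (does)

-- First-order formulae over ⊥, ∧, ∨, ⊃, ∀, ∃.
-- Bound variables and parameters are two disjoint sorts, both named by ℕ.
-- Atomic formulae p(t⃗): predicate symbol (ℕ) applied to a list of terms.

data Term : Set where
  var : ℕ → Term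
  par : ℕ → Term

data Formula : Set where
  atom : ℕ → List Term → Formula
  ⊥'   : Formula
  _∧'_ : Formula → Formula → Formula
  _∨'_ : Formula → Formula → Formula
  _⊃'_ : Formula → Formula → Formula
  ∀'   : ℕ → Formula → Formula
  ∃'   : ℕ → Formula → Formula

substT : Term → ℕ → ℕ → Term
substT (var y) a x = if does (x ≟ y) then par a else var y
substT (par b) a x = par b

_[_/_] : Formula → ℕ → ℕ → Formula
atom p ts [ a / x ] = atom p (map (λ t → substT t a x) ts)
⊥'        [ a / x ] = ⊥'
(A ∧' B)  [ a / x ] = (A [ a / x ]) ∧' (B [ a / x ])
(A ∨' B)  [ a / x ] = (A [ a / x ]) ∨' (B [ a / x ])
(A ⊃' B)  [ a / x ] = (A [ a / x ]) ⊃' (B [ a / x ])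
∀' y A    [ a / x ] = if does (x ≟ y) then ∀' y A else ∀' y (A [ a / x ])
∃' y A    [ a / x ] = if does (x ≟ y) then ∃' y A else ∃' y (A [ a / x ])

parsT : Term → List ℕ
parsT (var _) = []
parsT (par a) = a ∷ []

pars : Formula → List ℕ
pars (atom _ ts) = concatMap parsT ts
pars ⊥'          = []
pars (A ∧' B)    = pars A ++ pars B
pars (A ∨' B)    = pars A ++ pars B
pars (A ⊃' B)    = pars A ++ pars B
pars (∀' _ A)    = pars A
pars (∃' _ A)    = pars A

ClosedT : List ℕ → Term → Set
ClosedT ctx (var x) = x ∈ ctx
ClosedT ctx (par _) = ⊤

ClosedUnder : List ℕ → Formula → Set
ClosedUnder ctx (atom _ ts) = All (ClosedT ctx) ts
ClosedUnder ctx ⊥'          = ⊤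
ClosedUnder ctx (A ∧' B)    = ClosedUnder ctx A × ClosedUnder ctx B
ClosedUnder ctx (A ∨' B)    = ClosedUnder ctx A × ClosedUnder ctx B
ClosedUnder ctx (A ⊃' B)    = ClosedUnder ctx A × ClosedUnder ctx B
ClosedUnder ctx (∀' x A)    = ClosedUnder (x ∷ ctx) A
ClosedUnder ctx (∃' x A)    = ClosedUnder (x ∷ ctx) A

Closed : Formula → Set
Closed = ClosedUnder []

-- Linear nested sequents.  A component Γ ⊢ Δ has multisets Γ, Δ,
-- represented by lists modulo permutation (see the exchange rule below).

record Component : Set where
  constructor _⊢_
  field
    ant : List Formula
    suc : List Formula
open Component public

infix 4 _⊢_

LNS : Set
LNS = List Component

_⊕c_ : Component → Component → Component
(Γ₁ ⊢ Δ₁) ⊕c (Γ₂ ⊢ Δ₂) = (Γ₁ ++ Γ₂) ⊢ (Δ₁ ++ Δ₂)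

-- splice of two sequences of components (used only for equal lengths)
_⊕_ : LNS → LNS → LNS
_⊕_ = zipWith _⊕c_

_≈c_ : Component → Component → Set
c ≈c d = (ant c ↭ ant d) × (suc c ↭ suc d)

_≈_ : LNS → LNS → Set
_≈_ = Pointwise _≈c_

ClosedC : Component → Set
ClosedC c = All Closed (ant c) × All Closed (suc c)

ClosedLNS : LNS → Set
ClosedLNS = All ClosedC

parsC : Component → List ℕ
parsC c = concatMap pars (ant c) ++ concatMap pars (suc c)

parsLNS : LNS → List ℕ
parsLNS = concatMap parsC

Fresh : ℕ → LNS → Set
Fresh a S = a ∉ parsLNS S

withCut : Formula → ℕ × List Formula × List Formula → Component
withCut A (k , Γ , Δ) = (replicate k A ++ Γ) ⊢ Δ

noCut : ℕ × List Formula × List Formula → Component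
noCut (k , Γ , Δ) = Γ ⊢ Δ

-- LNIF, optionally extended with (cut).  Derivable c S:
-- c = false : LNIF;  c = true : LNIF + (cut).
-- Principal formulae are written at the head of their lists; since
-- components are multisets, an exchange rule closes derivability under
-- componentwise permutation.

data Derivable (c : Bool) : LNS → Set where
  exch : ∀ {S S'} → S ≈ S' → Derivable c S → Derivable c S'

  id₁ : ∀ G H Γ Δ p as →
    Derivable c (G ++ (atom p as ∷ Γ ⊢ atom p as ∷ Δ) ∷ H)
  id₂ : ∀ G H F Γ₁ Δ₁ Γ₂ Δ₂ p as →
    Derivable c (G ++ (atom p as ∷ Γ₁ ⊢ Δ₁) ∷ H ++ (Γ₂ ⊢ atom p as ∷ Δ₂) ∷ F)
  ⊥l : ∀ G H Γ Δ →
    Derivable c (G ++ (⊥' ∷ Γ ⊢ Δ) ∷ H)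

  ∧l : ∀ G H Γ Δ A B →
    Derivable c (G ++ (A ∷ B ∷ Γ ⊢ Δ) ∷ H) →
    Derivable c (G ++ ((A ∧' B) ∷ Γ ⊢ Δ) ∷ H)
  ∨r : ∀ G H Γ Δ A B →
    Derivable c (G ++ (Γ ⊢ A ∷ B ∷ Δ) ∷ H) →
    Derivable c (G ++ (Γ ⊢ (A ∨' B) ∷ Δ) ∷ H)
  ∧r : ∀ G H Γ Δ A B →
    Derivable c (G ++ (Γ ⊢ A ∷ Δ) ∷ H) →
    Derivable c (G ++ (Γ ⊢ B ∷ Δ) ∷ H) →
    Derivable c (G ++ (Γ ⊢ (A ∧' B) ∷ Δ) ∷ H)
  ∨l : ∀ G H Γ Δ A B →
    Derivable c (G ++ (A ∷ Γ ⊢ Δ) ∷ H) →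
    Derivable c (G ++ (B ∷ Γ ⊢ Δ) ∷ H) →
    Derivable c (G ++ ((A ∨' B) ∷ Γ ⊢ Δ) ∷ H)
  ⊃r₁ : ∀ G Γ Δ A B →
    Derivable c (G ++ (Γ ⊢ Δ) ∷ (A ∷ [] ⊢ B ∷ []) ∷ []) →
    Derivable c (G ++ (Γ ⊢ (A ⊃' B) ∷ Δ) ∷ [])
  ⊃l : ∀ G H Γ Δ A B →
    Derivable c (G ++ (B ∷ Γ ⊢ Δ) ∷ H) →
    Derivable c (G ++ ((A ⊃' B) ∷ Γ ⊢ A ∷ Δ) ∷ H) →
    Derivable c (G ++ ((A ⊃' B) ∷ Γ ⊢ Δ) ∷ H)
  lift : ∀ G H Γ₁ Δ₁ Γ₂ Δ₂ A →
    Derivable c (G ++ (A ∷ Γ₁ ⊢ Δ₁) ∷ (A ∷ Γ₂ ⊢ Δ₂) ∷ H) →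
    Derivable c (G ++ (A ∷ Γ₁ ⊢ Δ₁) ∷ (Γ₂ ⊢ Δ₂) ∷ H)
  ∀l : ∀ G H Γ Δ x A a →
    Derivable c (G ++ ((A [ a / x ]) ∷ ∀' x A ∷ Γ ⊢ Δ) ∷ H) →
    Derivable c (G ++ (∀' x A ∷ Γ ⊢ Δ) ∷ H)
  ∀r₁ : ∀ G Γ Δ x A a →
    Fresh a (G ++ (Γ ⊢ ∀' x A ∷ Δ) ∷ []) →
    Derivable c (G ++ (Γ ⊢ Δ) ∷ ([] ⊢ (A [ a / x ]) ∷ []) ∷ []) →
    Derivable c (G ++ (Γ ⊢ ∀' x A ∷ Δ) ∷ [])
  ∃l : ∀ G H Γ Δ x A a →
    Fresh a (G ++ (∃' x A ∷ Γ ⊢ Δ) ∷ H) →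
    Derivable c (G ++ ((A [ a / x ]) ∷ Γ ⊢ Δ) ∷ H) →
    Derivable c (G ++ (∃' x A ∷ Γ ⊢ Δ) ∷ H)
  ∃r : ∀ G H Γ Δ x A a →
    Derivable c (G ++ (Γ ⊢ (A [ a / x ]) ∷ ∃' x A ∷ Δ) ∷ H) →
    Derivable c (G ++ (Γ ⊢ ∃' x A ∷ Δ) ∷ H)
  ⊃r₂ : ∀ G H Γ₁ Δ₁ Γ₂ Δ₂ A B →
    Derivable c (G ++ (Γ₁ ⊢ Δ₁) ∷ (A ∷ [] ⊢ B ∷ []) ∷ (Γ₂ ⊢ Δ₂) ∷ H) →
    Derivable c (G ++ (Γ₁ ⊢ Δ₁) ∷ (Γ₂ ⊢ (A ⊃' B) ∷ Δ₂) ∷ H) →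
    Derivable c (G ++ (Γ₁ ⊢ (A ⊃' B) ∷ Δ₁) ∷ (Γ₂ ⊢ Δ₂) ∷ H)
  ∀r₂ : ∀ G H Γ₁ Δ₁ Γ₂ Δ₂ x A a →
    Fresh a (G ++ (Γ₁ ⊢ ∀' x A ∷ Δ₁) ∷ (Γ₂ ⊢ Δ₂) ∷ H) →
    Derivable c (G ++ (Γ₁ ⊢ Δ₁) ∷ ([] ⊢ (A [ a / x ]) ∷ []) ∷ (Γ₂ ⊢ Δ₂) ∷ H) →
    Derivable c (G ++ (Γ₁ ⊢ Δ₁) ∷ (Γ₂ ⊢ ∀' x A ∷ Δ₂) ∷ H) →
    Derivable c (G ++ (Γ₁ ⊢ ∀' x A ∷ Δ₁) ∷ (Γ₂ ⊢ Δ₂) ∷ H)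

  cut : c ≡ true → ∀ G H F Γ Δ A k₁ Γ₁ Δ₁ rest →
    Closed A →
    length G ≡ length F →
    length H ≡ length rest →
    1 ≤ k₁ + sum (map proj₁ rest) →
    Derivable c (G ++ (Γ ⊢ A ∷ Δ) ∷ H) →
    Derivable c (F ++ withCut A (k₁ , Γ₁ , Δ₁) ∷ map (withCut A) rest) →
    Derivable c ((G ⊕ F) ++ ((Γ ++ Γ₁) ⊢ (Δ ++ Δ₁)) ∷ (H ⊕ map noCut rest))

module Submission where

-- A derivation is read as a closed tableau of entries q ⊩ A (A holds at q) and q ⊮ A over the dense linear
-- order ℚ of worlds, in which a rule that opens a component branches over all worlds r ≥ q and an eigenvariable
-- over all parameters. Merging of components, renaming, weakening and contraction are then immediate, every rule
-- for ⊮⊃, ⊮∀ and ⊩∃ is inverted by choosing a branch, and cut is eliminated by induction on the cut formula and on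
-- one premise; lift is a cut against an identity. Conversely, a closed tableau is turned into a derivation of any
-- labelled sequent that contains each of its entries or already contains what the entry decomposes into, which
-- dispenses with invertibility and contraction in LNIF; density of ℚ gives labels for the components opened.

open import Defs hiding (suc)
open import Data.Bool using (Bool; true; false; if_then_else_)
open import Data.Empty using (⊥; ⊥-elim)
open import Data.List using (List; []; _∷_; _++_; map; length; concatMap)
open import Data.List.Membership.Propositional using (_∈_; _∉_)
open import Data.List.Membership.Propositional.Properties
  using (∈-++⁺ˡ; ∈-++⁺ʳ; ∈-++⁻; ∈-map⁺; ∈-map⁻; ∈-∃++)
open import Data.List.Properties using (concatMap-++; length-map; map-++; ++-assoc)
open import Data.List.Relation.Binary.Permutation.Propositional using (_↭_; ↭-refl; ↭-sym)
open import Data.List.Relation.Binary.Permutation.Propositional.Properties using (All-resp-↭; ∈-resp-↭; shift)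
open import Data.List.Relation.Binary.Pointwise as Pointwise using (Pointwise; []; _∷_)
open import Data.List.Relation.Binary.Subset.Propositional using (_⊆_)
open import Data.List.Relation.Binary.Subset.Propositional.Properties
  using (⊆-refl; ++⁺; ++⁺ʳ; ++⁺ˡ; ∷⁺ʳ; xs⊆ys++xs; xs⊆x∷xs; map⁺)
open import Data.List.Relation.Unary.All as All using (All; []; _∷_)
import Data.List.Relation.Unary.All.Properties as All
open import Data.List.Relation.Unary.AllPairs using (AllPairs; []; _∷_)
open import Data.List.Relation.Unary.Any using (here; there)
open import Data.Nat as ℕ using (ℕ; suc; _≟_)
open import Data.Nat.ListAction using (sum)
import Data.Nat.Properties as ℕ
open import Data.Product using (_×_; _,_; proj₁; proj₂; ∃; ∃₂; uncurry)
open import Data.Rational using (ℚ; _≤_; _<_; _+_; 0ℚ; 1ℚ)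
open import Data.Rational.Properties
  using (≤-refl; ≤-trans; ≤-total; <⇒≤; <-irrefl; <-trans; <-≤-trans; <-dense; +-identityʳ; +-monoʳ-<; positive⁻¹)
open import Data.Sum using (_⊎_; inj₁; inj₂; [_,_]′)
open import Data.Unit using (⊤; tt)
open import Function using (_∘_; id)
open import Relation.Binary.PropositionalEquality using (_≡_; refl; sym; trans; cong; cong₂; subst)
open import Relation.Nullary using (¬_; yes; no; does; contradiction)

-- The labelled calculus and its cut elimination

infix 5 _⊩_ _⊮_

-- at q records that the world q is available to ⊩⊃ and ⊩∀; those rules need it to find a component there.
data Entry : Set where
  at      : ℚ → Entry
  _⊩_ _⊮_ : ℚ → Formula → Entry

-- Choices made in applying a rule (a world, an instance) are constructor arguments; choices that
-- every application must answer are collected in `Branch`. Indexing by the principal entry makes it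
-- possible to say that an entry has only one rule.
data Rule : Entry → Set where
  close : ∀ {q r p ts} → q ≤ r → Rule (q ⊩ atom p ts)
  ⊩⊥ : ∀ {q} → Rule (q ⊩ ⊥')
  ⊩∧ : ∀ {q A B} → Rule (q ⊩ (A ∧' B))
  ⊮∧ : ∀ {q A B} → Rule (q ⊮ (A ∧' B))
  ⊩∨ : ∀ {q A B} → Rule (q ⊩ (A ∨' B))
  ⊮∨ : ∀ {q A B} → Rule (q ⊮ (A ∨' B))
  ⊩⊃ : ∀ {q r A B} → q ≤ r → Rule (q ⊩ (A ⊃' B))
  ⊮⊃ : ∀ {q A B} → Rule (q ⊮ (A ⊃' B))
  ⊩∀ : ∀ {q r x A} → q ≤ r → ℕ → Rule (q ⊩ ∀' x A)
  ⊮∀ : ∀ {q x A} → Rule (q ⊮ ∀' x A)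
  ⊩∃ : ∀ {q x A} → Rule (q ⊩ ∃' x A)
  ⊮∃ : ∀ {q x A} → ℕ → Rule (q ⊮ ∃' x A)

Branch : ∀ {e} → Rule e → Set
Branch (close _)    = ⊥
Branch ⊩⊥           = ⊥
Branch ⊩∧           = ⊤
Branch ⊮∧           = Bool
Branch ⊩∨           = Bool
Branch ⊮∨           = ⊤
Branch (⊩⊃ _)       = Bool
Branch (⊮⊃ {q})     = ∃ λ r → q ≤ r
Branch (⊩∀ _ _)     = ⊤
Branch (⊮∀ {q})     = (∃ λ r → q ≤ r) × ℕ
Branch ⊩∃           = ℕ
Branch (⊮∃ _)       = ⊤

side : ∀ {e} → Rule e → List Entry
side (close {r = r} {p} {ts} _) = (r ⊮ atom p ts) ∷ []
side (⊩⊃ {r = r} _)             = at r ∷ []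
side (⊩∀ {r = r} _ _)           = at r ∷ []
side _                          = []

new : ∀ {e} (ρ : Rule e) → Branch ρ → List Entry
new (⊩∧ {q} {A} {B}) _             = (q ⊩ A) ∷ (q ⊩ B) ∷ []
new (⊮∧ {q} {A} {B}) b             = (q ⊮ (if b then A else B)) ∷ []
new (⊩∨ {q} {A} {B}) b             = (q ⊩ (if b then A else B)) ∷ []
new (⊮∨ {q} {A} {B}) _             = (q ⊮ A) ∷ (q ⊮ B) ∷ []
new (⊩⊃ {r = r} {A} {B} _) true    = (r ⊩ B) ∷ []
new (⊩⊃ {r = r} {A} {B} _) false   = (r ⊮ A) ∷ []
new (⊮⊃ {A = A} {B}) (r , _)       = at r ∷ (r ⊩ A) ∷ (r ⊮ B) ∷ []
new (⊩∀ {r = r} {x} {A} _ a) _     = (r ⊩ (A [ a / x ])) ∷ []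
new (⊮∀ {q} {x} {A}) ((r , _) , a) = at r ∷ (r ⊮ (A [ a / x ])) ∷ []
new (⊩∃ {q} {x} {A}) a             = (q ⊩ (A [ a / x ])) ∷ []
new (⊮∃ {q} {x} {A} a) _           = (q ⊮ (A [ a / x ])) ∷ []

-- Premises keep the principal entry, so `Θ` acts as a growing set. Branching may be infinite, so a
-- derivation carries no numerical height and inductions follow the tree itself.
data Closes (Θ : List Entry) : Set where
  by : ∀ {e} (ρ : Rule e) → e ∈ Θ → side ρ ⊆ Θ →
       (∀ b → Closes (new ρ b ++ Θ)) → Closes Θ

weaken : ∀ {Θ Θ'} → Θ ⊆ Θ' → Closes Θ → Closes Θ'
weaken s (by ρ m c k) = by ρ (s m) (s ∘ c) λ b → weaken (++⁺ʳ (new ρ b) s) (k b)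

contract : ∀ {Θ Ψ} → Ψ ⊆ Θ → Closes (Ψ ++ Θ) → Closes Θ
contract {Ψ = Ψ} s = weaken λ m → [ s , id ]′ (∈-++⁻ Ψ m)

exchange : ∀ {Θ : List Entry} {e} Ψ → Ψ ++ (e ∷ Θ) ⊆ e ∷ (Ψ ++ Θ)
exchange Ψ m with ∈-++⁻ Ψ m
... | inj₁ n         = there (∈-++⁺ˡ n)
... | inj₂ (here eq) = here eq
... | inj₂ (there n) = there (∈-++⁺ʳ Ψ n)

-- The two hypotheses say how to close when e is principal and when e is a side entry.
delete : ∀ {e Θ Ψ} →
  (∀ {Θ'} → Θ ⊆ Θ' → (ρ : Rule e) → side ρ ⊆ e ∷ Θ' → (∀ b → Closes (new ρ b ++ Θ')) → Closes Θ') →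
  (∀ {Θ' e'} → Θ ⊆ Θ' → (ρ : Rule e') → e ∈ side ρ → e' ∈ Θ' → Closes Θ') →
  Ψ ⊆ e ∷ Θ → Closes Ψ → Closes Θ
delete {e} {Θ} main aside = go ⊆-refl
  where
  -- The case distinction reads off where the given membership proofs point, so no decidable
  -- equality of entries is involved.
  split : ∀ {Θ'} Φ → Φ ⊆ e ∷ Θ' → e ∈ Φ ⊎ Φ ⊆ Θ'
  split [] s = inj₂ λ ()
  split (x ∷ Φ) s with s (here refl) | split Φ (s ∘ there)
  ... | here refl | _      = inj₁ (here refl)
  ... | there _   | inj₁ m = inj₁ (there m)
  ... | there m   | inj₂ t = inj₂ λ { (here refl) → m ; (there n) → t n }

  go : ∀ {Θ' Ψ} → Θ ⊆ Θ' → Ψ ⊆ e ∷ Θ' → Closes Ψ → Closes Θ'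
  go {Θ'} w s (by ρ m c k) = principal ρ (s m) (s ∘ c) λ b →
      go (xs⊆ys++xs _ _ ∘ w) (exchange (new ρ b) ∘ ++⁺ʳ (new ρ b) s) (k b)
    where
    principal : ∀ {e'} (ρ : Rule e') → e' ∈ e ∷ Θ' → side ρ ⊆ e ∷ Θ' → (∀ b → Closes (new ρ b ++ Θ')) → Closes Θ'
    principal ρ (here refl) c k = main w ρ c k
    principal ρ (there m) c k with split (side ρ) c
    ... | inj₁ n = aside w ρ n m
    ... | inj₂ t = by ρ m t k

-- For every entry outside these two shapes, deletion has to treat only the inferences where the
-- entry is principal.
IsSide : Entry → Set
IsSide (at _)            = ⊤
IsSide (_ ⊮ atom _ _)    = ⊤
IsSide _                 = ⊥

side-isSide : ∀ {e y} (ρ : Rule e) → y ∈ side ρ → IsSide y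
side-isSide (close _) (here refl) = tt
side-isSide (⊩⊃ _)    (here refl) = tt
side-isSide (⊩∀ _ _)  (here refl) = tt

delete-principal : ∀ {e Θ} → ¬ IsSide e →
  (∀ {Θ'} → Θ ⊆ Θ' → (ρ : Rule e) → side ρ ⊆ Θ' → (∀ b → Closes (new ρ b ++ Θ')) → Closes Θ') →
  Closes (e ∷ Θ) → Closes Θ
delete-principal ns main = delete
  (λ w ρ c k → main w ρ (λ m → tail (side-isSide ρ m) (c m)) k)
  (λ w ρ m _ → ⊥-elim (ns (side-isSide ρ m)))
  ⊆-refl
  where
  tail : ∀ {y Φ} → IsSide y → y ∈ _ ∷ Φ → y ∈ Φ
  tail i (here refl) = ⊥-elim (ns i)
  tail i (there m)   = m

-- Each inference with `e` principal must be `ρ`, so it has a premise for `b`. That premise replaces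
-- the inference, since its new entries are present already. For `⊮⊃` and `⊮∀` this permits any
-- later world and any parameter.
invert : ∀ {e Θ} → ¬ IsSide e → (ρ : Rule e) → (∀ ρ' → ρ' ≡ ρ) → ∀ b → Closes (e ∷ Θ) → Closes (new ρ b ++ Θ)
invert {e} {Θ} ns ρ unique b d = delete-principal ns main (weaken (∷⁺ʳ e (xs⊆ys++xs _ _)) d)
  where
  main : ∀ {Θ'} → new ρ b ++ Θ ⊆ Θ' → (ρ' : Rule e) → side ρ' ⊆ Θ' → (∀ b → Closes (new ρ' b ++ Θ')) → Closes Θ'
  main w ρ' _ k with refl ← unique ρ' = contract (w ∘ ∈-++⁺ˡ) (k b)

-- Admissibility of cut and identity in the tableau calculus

size : Formula → ℕ
size (atom _ _) = 0
size ⊥'         = 0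
size (A ∧' B)   = suc (size A ℕ.+ size B)
size (A ∨' B)   = suc (size A ℕ.+ size B)
size (A ⊃' B)   = suc (size A ℕ.+ size B)
size (∀' _ A)   = suc (size A)
size (∃' _ A)   = suc (size A)

size-subst : ∀ A a x → size (A [ a / x ]) ≡ size A
size-subst (atom _ _) a x = refl
size-subst ⊥'         a x = refl
size-subst (A ∧' B)   a x = cong suc (cong₂ ℕ._+_ (size-subst A a x) (size-subst B a x))
size-subst (A ∨' B)   a x = cong suc (cong₂ ℕ._+_ (size-subst A a x) (size-subst B a x))
size-subst (A ⊃' B)   a x = cong suc (cong₂ ℕ._+_ (size-subst A a x) (size-subst B a x))
size-subst (∀' y A)   a x with does (x ≟ y)
... | true  = refl
... | false = cong suc (size-subst A a x)
size-subst (∃' y A)   a x with does (x ≟ y)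
... | true  = refl
... | false = cong suc (size-subst A a x)

module _ {A B : Formula} {n} (h : suc (size A ℕ.+ size B) ℕ.≤ suc n) where
  sizeˡ : size A ℕ.≤ n
  sizeˡ = ℕ.≤-trans (ℕ.m≤m+n _ _) (ℕ.≤-pred h)
  sizeʳ : size B ℕ.≤ n
  sizeʳ = ℕ.≤-trans (ℕ.m≤n+m _ (size A)) (ℕ.≤-pred h)

size-instance : ∀ {A n} a x → suc (size A) ℕ.≤ suc n → size (A [ a / x ]) ℕ.≤ n
size-instance {A} a x h = subst (ℕ._≤ _) (sym (size-subst A a x)) (ℕ.≤-pred h)

Admissible : Formula → Set
Admissible A = ∀ {Θ q} → Closes ((q ⊮ A) ∷ Θ) → Closes ((q ⊩ A) ∷ Θ) → Closes Θ

⊆-second : ∀ {e y} {Θ : List Entry} → e ∷ Θ ⊆ e ∷ y ∷ Θ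
⊆-second = ∷⁺ʳ _ (xs⊆x∷xs _ _)

-- An inference closing on `q ⊩ p` exhibits `r ⊮ p` with `q ≤ r`. In the other tableau `q ⊮ p` is
-- never principal; where it serves to close against some `k ⊩ p` with `k ≤ q`, the entry `r ⊮ p`
-- serves as well by transitivity.
cut-atom : ∀ p ts → Admissible (atom p ts)
cut-atom p ts {Θ} {q} d = delete-principal (λ ()) main
  where
  main : ∀ {Θ'} → Θ ⊆ Θ' → (ρ : Rule (q ⊩ atom p ts)) → side ρ ⊆ Θ' → _ → Closes Θ'
  main w (close q≤r) c _ = delete
    (λ { _ () })
    (λ { w' (close k≤q) (here refl) m →
           by (close (≤-trans k≤q q≤r)) m (λ { (here refl) → w' (c (here refl)) }) λ () ;
         w' (⊩⊃ _) (here ()) ;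
         w' (⊩∀ _ _) (here ()) })
    ⊆-refl (weaken (∷⁺ʳ _ w) d)

-- The induction is on a bound for the size because `A [ a / x ]` is not a structural part of a
-- quantified formula. For conjunction and disjunction both premises are inverted. For implication
-- and `∀'` only the `⊮` premise is inverted, at the world and instance used by each principal
-- inference of the other; for `∃'` the roles are exchanged.
cut-size : ∀ n A → size A ℕ.≤ n → Admissible A
cut-size n       (atom p ts) h d e = cut-atom p ts d e
cut-size n       ⊥'          h d e = delete-principal (λ ()) (λ { _ () }) d
cut-size (suc n) (A ∧' B)    h d e =
  cut-size n A (sizeˡ {A} {B} h) (invert (λ ()) ⊮∧ (λ { ⊮∧ → refl }) true d)
    (cut-size n B (sizeʳ {A} {B} h)
      (weaken ⊆-second (invert (λ ()) ⊮∧ (λ { ⊮∧ → refl }) false d))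
      (weaken (λ { (here p) → there (here p) ; (there (here p)) → here p ; (there (there m)) → there (there m) })
        (invert (λ ()) ⊩∧ (λ { ⊩∧ → refl }) tt e)))
cut-size (suc n) (A ∨' B)    h d e =
  cut-size n B (sizeʳ {A} {B} h)
    (cut-size n A (sizeˡ {A} {B} h)
      (invert (λ ()) ⊮∨ (λ { ⊮∨ → refl }) tt d)
      (weaken ⊆-second (invert (λ ()) ⊩∨ (λ { ⊩∨ → refl }) true e)))
    (invert (λ ()) ⊩∨ (λ { ⊩∨ → refl }) false e)
cut-size (suc n) (A ⊃' B)    h {Θ} {q} d e = delete-principal (λ ()) main e
  where
  main : ∀ {Θ'} → Θ ⊆ Θ' → (ρ : Rule (q ⊩ (A ⊃' B))) → side ρ ⊆ Θ' → (∀ b → Closes (new ρ b ++ Θ')) → Closes Θ'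
  main w (⊩⊃ {r = r} q≤r) c k =
    -- Inverting `d` at `r` yields `at r`, `r ⊩ A` and `r ⊮ B`. The first is already there as the
    -- side entry of `⊩⊃`; the other two are cut.
    cut-size n A (sizeˡ {A} {B} h) (k false)
      (cut-size n B (sizeʳ {A} {B} h)
        (weaken (λ { (here refl) → there (there (c (here refl))) ; (there (here p)) → there (here p)
                   ; (there (there (here p))) → here p ; (there (there (there m))) → there (there (w m)) })
          (invert (λ ()) ⊮⊃ (λ { ⊮⊃ → refl }) (r , q≤r) d))
        (weaken ⊆-second (k true)))
cut-size (suc n) (∀' x A)    h {Θ} {q} d e = delete-principal (λ ()) main e
  where
  main : ∀ {Θ'} → Θ ⊆ Θ' → (ρ : Rule (q ⊩ ∀' x A)) → side ρ ⊆ Θ' → (∀ b → Closes (new ρ b ++ Θ')) → Closes Θ'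
  main w (⊩∀ {r = r} q≤r a) c k = cut-size n (A [ a / x ]) (size-instance a x h)
    (weaken (λ { (here refl) → there (c (here refl)) ; (there (here p)) → here p ; (there (there m)) → there (w m) })
      (invert (λ ()) ⊮∀ (λ { ⊮∀ → refl }) ((r , q≤r) , a) d))
    (k tt)
cut-size (suc n) (∃' x A)    h {Θ} {q} d e = delete-principal (λ ()) main d
  where
  main : ∀ {Θ'} → Θ ⊆ Θ' → (ρ : Rule (q ⊮ ∃' x A)) → side ρ ⊆ Θ' → (∀ b → Closes (new ρ b ++ Θ')) → Closes Θ'
  main w (⊮∃ a) c k = cut-size n (A [ a / x ]) (size-instance a x h) (k tt)
    (weaken (∷⁺ʳ _ w) (invert (λ ()) ⊩∃ (λ { ⊩∃ → refl }) a e))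

cut-admissible : ∀ A → Admissible A
cut-admissible A = cut-size (size A) A ℕ.≤-refl

-- Both entries are decomposed in turn. The one that branches over worlds or parameters goes first,
-- so that the other can be instantiated with what the branch supplies; for implication and `∀'` it
-- also supplies the required `at s`.
identity-size : ∀ n A → size A ℕ.≤ n → ∀ {Θ q r} → q ≤ r → (q ⊩ A) ∈ Θ → (r ⊮ A) ∈ Θ → Closes Θ
identity-size n (atom p ts) h q≤r m m' = by (close q≤r) m (λ { (here refl) → m' }) λ ()
identity-size n ⊥' h q≤r m m' = by ⊩⊥ m (λ ()) λ ()
identity-size (suc n) (A ∧' B) h q≤r m m' =
  by ⊩∧ m (λ ()) λ _ → by ⊮∧ (there (there m')) (λ ()) λ
    { true  → identity-size n A (sizeˡ {A} {B} h) q≤r (there (here refl)) (here refl)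
    ; false → identity-size n B (sizeʳ {A} {B} h) q≤r (there (there (here refl))) (here refl) }
identity-size (suc n) (A ∨' B) h q≤r m m' =
  by ⊮∨ m' (λ ()) λ _ → by ⊩∨ (there (there m)) (λ ()) λ
    { true  → identity-size n A (sizeˡ {A} {B} h) q≤r (here refl) (there (here refl))
    ; false → identity-size n B (sizeʳ {A} {B} h) q≤r (here refl) (there (there (here refl))) }
identity-size (suc n) (A ⊃' B) h q≤r m m' =
  by ⊮⊃ m' (λ ()) λ { (s , r≤s) →
    by (⊩⊃ (≤-trans q≤r r≤s)) (there (there (there m))) (λ { (here refl) → here refl }) λ
      { true  → identity-size n B (sizeʳ {A} {B} h) ≤-refl (here refl) (there (there (there (here refl))))
      ; false → identity-size n A (sizeˡ {A} {B} h) ≤-refl (there (there (here refl))) (here refl) } }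
identity-size (suc n) (∀' x A) h q≤r m m' =
  by ⊮∀ m' (λ ()) λ { ((s , r≤s) , a) →
    by (⊩∀ (≤-trans q≤r r≤s) a) (there (there m)) (λ { (here refl) → here refl }) λ _ →
      identity-size n (A [ a / x ]) (size-instance a x h) ≤-refl (here refl) (there (there (here refl))) }
identity-size (suc n) (∃' x A) h q≤r m m' =
  by ⊩∃ m (λ ()) λ a → by (⊮∃ a) (there m') (λ ()) λ _ →
    identity-size n (A [ a / x ]) (size-instance a x h) q≤r (there (here refl)) (here refl)

identity : ∀ A {Θ q r} → q ≤ r → (q ⊩ A) ∈ Θ → (r ⊮ A) ∈ Θ → Closes Θ
identity A = identity-size (size A) A ℕ.≤-refl

lift-admissible : ∀ A {Θ q r} → q ≤ r → (q ⊩ A) ∈ Θ → Closes ((r ⊩ A) ∷ Θ) → Closes Θ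
lift-admissible A q≤r m = cut-admissible A (identity A q≤r (there m) (here refl))

-- What fails at `r` fails at every earlier `q`. This carries the left premise of a cut to the
-- worlds of all later components.
lower-admissible : ∀ A {Θ q r} → q ≤ r → Closes ((q ⊮ A) ∷ Θ) → Closes ((r ⊮ A) ∷ Θ)
lower-admissible A q≤r d = cut-admissible A (weaken ⊆-second d) (identity A q≤r (here refl) (there (here refl)))

-- From LNIF with cut to closed tableaux

renT : (ℕ → ℕ) → Term → Term
renT σ (var x) = var x
renT σ (par a) = par (σ a)

ren : (ℕ → ℕ) → Formula → Formula
ren σ (atom p ts) = atom p (map (renT σ) ts)
ren σ ⊥'          = ⊥'
ren σ (A ∧' B)    = ren σ A ∧' ren σ B
ren σ (A ∨' B)    = ren σ A ∨' ren σ B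
ren σ (A ⊃' B)    = ren σ A ⊃' ren σ B
ren σ (∀' x A)    = ∀' x (ren σ A)
ren σ (∃' x A)    = ∃' x (ren σ A)

-- Renaming acts on parameters and substitution on variables; as the two sorts are disjoint, nothing
-- can be captured and `σ` need not be injective.
ren-subst : ∀ σ A a x → ren σ (A [ a / x ]) ≡ (ren σ A) [ σ a / x ]
ren-subst σ (atom p ts) a x = cong (atom p) (terms ts)
  where
  terms : ∀ ts → map (renT σ) (map (λ t → substT t a x) ts) ≡ map (λ t → substT t (σ a) x) (map (renT σ) ts)
  terms []           = refl
  terms (par b ∷ ts) = cong (_ ∷_) (terms ts)
  terms (var y ∷ ts) with does (x ≟ y)
  ... | true  = cong (_ ∷_) (terms ts)
  ... | false = cong (_ ∷_) (terms ts)
ren-subst σ ⊥'       a x = refl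
ren-subst σ (A ∧' B) a x = cong₂ _∧'_ (ren-subst σ A a x) (ren-subst σ B a x)
ren-subst σ (A ∨' B) a x = cong₂ _∨'_ (ren-subst σ A a x) (ren-subst σ B a x)
ren-subst σ (A ⊃' B) a x = cong₂ _⊃'_ (ren-subst σ A a x) (ren-subst σ B a x)
ren-subst σ (∀' y A) a x with does (x ≟ y)
... | true  = refl
... | false = cong (∀' y) (ren-subst σ A a x)
ren-subst σ (∃' y A) a x with does (x ≟ y)
... | true  = refl
... | false = cong (∃' y) (ren-subst σ A a x)

ren-id : ∀ A → ren id A ≡ A
ren-id (atom p ts) = cong (atom p) (terms ts)
  where
  terms : ∀ ts → map (renT id) ts ≡ ts
  terms []           = refl
  terms (var _ ∷ ts) = cong (_ ∷_) (terms ts)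
  terms (par _ ∷ ts) = cong (_ ∷_) (terms ts)
ren-id ⊥'       = refl
ren-id (A ∧' B) = cong₂ _∧'_ (ren-id A) (ren-id B)
ren-id (A ∨' B) = cong₂ _∨'_ (ren-id A) (ren-id B)
ren-id (A ⊃' B) = cong₂ _⊃'_ (ren-id A) (ren-id B)
ren-id (∀' x A) = cong (∀' x) (ren-id A)
ren-id (∃' x A) = cong (∃' x) (ren-id A)

Agree : (σ τ : ℕ → ℕ) → List ℕ → Set
Agree σ τ as = ∀ {a} → a ∈ as → σ a ≡ τ a

ren-cong : ∀ {σ τ} A → Agree σ τ (pars A) → ren σ A ≡ ren τ A
ren-cong {σ} {τ} (atom p ts) e = cong (atom p) (terms ts e)
  where
  terms : ∀ ts → Agree σ τ (concatMap parsT ts) → map (renT σ) ts ≡ map (renT τ) ts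
  terms []           e = refl
  terms (var _ ∷ ts) e = cong (_ ∷_) (terms ts e)
  terms (par _ ∷ ts) e = cong₂ _∷_ (cong par (e (here refl))) (terms ts (e ∘ there))
ren-cong ⊥'       e = refl
ren-cong (A ∧' B) e = cong₂ _∧'_ (ren-cong A (e ∘ ∈-++⁺ˡ)) (ren-cong B (e ∘ ∈-++⁺ʳ (pars A)))
ren-cong (A ∨' B) e = cong₂ _∨'_ (ren-cong A (e ∘ ∈-++⁺ˡ)) (ren-cong B (e ∘ ∈-++⁺ʳ (pars A)))
ren-cong (A ⊃' B) e = cong₂ _⊃'_ (ren-cong A (e ∘ ∈-++⁺ˡ)) (ren-cong B (e ∘ ∈-++⁺ʳ (pars A)))
ren-cong (∀' x A) e = cong (∀' x) (ren-cong A e)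
ren-cong (∃' x A) e = cong (∃' x) (ren-cong A e)

_⟨_↦_⟩ : (ℕ → ℕ) → ℕ → ℕ → ℕ → ℕ
(σ ⟨ a ↦ b ⟩) c with c ≟ a
... | yes _ = b
... | no _  = σ c

update-agrees : ∀ σ {a} b {as} → a ∉ as → Agree σ (σ ⟨ a ↦ b ⟩) as
update-agrees σ {a} b a∉ {c} m with c ≟ a
... | yes refl = contradiction m a∉
... | no _     = refl

update-hit : ∀ σ a b → (σ ⟨ a ↦ b ⟩) a ≡ b
update-hit σ a b with a ≟ a
... | yes _ = refl
... | no ne = contradiction refl ne

-- Identifies the tableau branch for the parameter `b` with the eigenvariable premise read under the
-- updated renaming.
ren-instance : ∀ {σ a b} x A → a ∉ pars A → (ren σ A) [ b / x ] ≡ ren (σ ⟨ a ↦ b ⟩) (A [ a / x ])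
ren-instance {σ} {a} {b} x A a∉
  rewrite ren-subst (σ ⟨ a ↦ b ⟩) A a x | update-hit σ a b | ren-cong A (update-agrees σ b a∉) = refl

-- Only membership is recorded, so multiplicities and the order inside a component are forgotten.
Holds : (ℕ → ℕ) → List Entry → ℚ → Component → Set
Holds σ Θ q (Γ ⊢ Δ) = at q ∈ Θ × All (λ A → (q ⊩ ren σ A) ∈ Θ) Γ × All (λ A → (q ⊮ ren σ A) ∈ Θ) Δ

-- The components of S occur in Θ, renamed by σ, at a weakly increasing sequence of worlds starting at or after i;
-- equal worlds are allowed, so components may be merged.
data Fits (σ : ℕ → ℕ) (Θ : List Entry) (i : ℚ) : LNS → Set where
  []  : Fits σ Θ i []
  fit : ∀ {q c S} → i ≤ q → Holds σ Θ q c → Fits σ Θ q S → Fits σ Θ i (c ∷ S)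

Holds-map : ∀ {σ τ Θ Θ' q} c → Θ ⊆ Θ' → Agree σ τ (parsC c) → Holds σ Θ q c → Holds τ Θ' q c
Holds-map {σ} {τ} {Θ} {Θ'} {q} (Γ ⊢ Δ) s e (w , l , r) =
  s w , go (q ⊩_) Γ (e ∘ ∈-++⁺ˡ) l , go (q ⊮_) Δ (e ∘ ∈-++⁺ʳ (concatMap pars Γ)) r
  where
  go : ∀ (f : Formula → Entry) Γ → Agree σ τ (concatMap pars Γ) →
       All (λ A → f (ren σ A) ∈ Θ) Γ → All (λ A → f (ren τ A) ∈ Θ') Γ
  go f []      e []       = []
  go f (A ∷ Γ) e (p ∷ ps) = subst (λ B → f B ∈ Θ') (ren-cong A (e ∘ ∈-++⁺ˡ)) (s p) ∷ go f Γ (e ∘ ∈-++⁺ʳ (pars A)) ps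

Fits-map : ∀ {σ τ Θ Θ' i S} → Θ ⊆ Θ' → Agree σ τ (parsLNS S) → Fits σ Θ i S → Fits τ Θ' i S
Fits-map s e []                    = []
Fits-map s e (fit {c = c} i≤q h f) = fit i≤q (Holds-map c s (e ∘ ∈-++⁺ˡ) h) (Fits-map s (e ∘ ∈-++⁺ʳ (parsC c)) f)

same : ∀ σ as → Agree σ σ as
same _ _ _ = refl

Holds-mono : ∀ {σ Θ Θ' q c} → Θ ⊆ Θ' → Holds σ Θ q c → Holds σ Θ' q c
Holds-mono {σ} {c = c} s = Holds-map c s (same σ (parsC c))

Fits-mono : ∀ {σ Θ Θ' i S} → Θ ⊆ Θ' → Fits σ Θ i S → Fits σ Θ' i S
Fits-mono {σ} {S = S} s = Fits-map s (same σ (parsLNS S))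

Fits-from : ∀ {σ Θ i j S} → i ≤ j → Fits σ Θ j S → Fits σ Θ i S
Fits-from i≤j []            = []
Fits-from i≤j (fit j≤q h f) = fit (≤-trans i≤j j≤q) h f

Fits-exchange : ∀ {σ Θ i S S'} → S ≈ S' → Fits σ Θ i S' → Fits σ Θ i S
Fits-exchange [] [] = []
Fits-exchange ((p , p') ∷ ps) (fit i≤q (w , l , r) f) =
  fit i≤q (w , All-resp-↭ (↭-sym p) l , All-resp-↭ (↭-sym p') r) (Fits-exchange ps f)

-- A zipper: behind the prefix `G`, `plug` accepts any new remainder `Y`, even after `Θ` has grown
-- and an eigenvariable fresh for `G` has been reassigned.
record Focus σ Θ i G X : Set where
  constructor focused
  field
    {start} : ℚ
    i≤start : i ≤ start
    here-fits : Fits σ Θ start X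
    plug : ∀ {τ Θ' Y} → Θ ⊆ Θ' → Agree σ τ (parsLNS G) → Fits τ Θ' start Y → Fits τ Θ' i (G ++ Y)

focus : ∀ {σ Θ i} G {X} → Fits σ Θ i (G ++ X) → Focus σ Θ i G X
focus [] f = focused ≤-refl f λ _ _ g → g
focus (c ∷ G) (fit i≤q h f) with focused q≤j g plug ← focus G f =
  focused (≤-trans i≤q q≤j) g λ s e g → fit i≤q (Holds-map c s (e ∘ ∈-++⁺ˡ) h) (plug s (e ∘ ∈-++⁺ʳ (parsC c)) g)

-- The zipper for a spliced prefix: either summand alone fits at the same worlds, which prepares the
-- two premises of a cut.
record Unzip σ Θ i G F X : Set where
  constructor unzipped
  field
    {start} : ℚ
    here-fits : Fits σ Θ start X
    plugˡ : ∀ {Θ' Y} → Θ ⊆ Θ' → Fits σ Θ' start Y → Fits σ Θ' i (G ++ Y)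
    plugʳ : ∀ {Θ' Y} → Θ ⊆ Θ' → Fits σ Θ' start Y → Fits σ Θ' i (F ++ Y)

Holds-unsplice : ∀ {σ Θ q} c d → Holds σ Θ q (c ⊕c d) → Holds σ Θ q c × Holds σ Θ q d
Holds-unsplice (Γ₁ ⊢ Δ₁) (Γ₂ ⊢ Δ₂) (w , l , r) =
  (w , All.++⁻ˡ Γ₁ l , All.++⁻ˡ Δ₁ r) , (w , All.++⁻ʳ Γ₁ l , All.++⁻ʳ Δ₁ r)

unzip-prefix : ∀ {σ Θ i} G F {X} → length G ≡ length F → Fits σ Θ i ((G ⊕ F) ++ X) → Unzip σ Θ i G F X
unzip-prefix [] [] eq f = unzipped f (λ _ g → g) (λ _ g → g)
unzip-prefix (c ∷ G) (d ∷ F) eq (fit i≤q h f)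
  with hc , hd ← Holds-unsplice c d h
  with unzipped g pl pr ← unzip-prefix G F (cong ℕ.pred eq) f =
  unzipped g (λ s g → fit i≤q (Holds-mono s hc) (pl s g)) (λ s g → fit i≤q (Holds-mono s hd) (pr s g))

unzip : ∀ {σ Θ i} G F → length G ≡ length F → Fits σ Θ i (G ⊕ F) → Fits σ Θ i G × Fits σ Θ i F
unzip [] [] eq [] = [] , []
unzip (c ∷ G) (d ∷ F) eq (fit i≤q h f)
  with hc , hd ← Holds-unsplice c d h
  with g , g' ← unzip G F (cong ℕ.pred eq) f = fit i≤q hc g , fit i≤q hd g'

-- One tableau cut is made at the world of each component, against the refutation of `A` moved up to
-- that world. The single entry obtained serves for all copies of `A` in the component.
cut-everywhere : ∀ {σ Θ q r} A rest → q ≤ r → Fits σ Θ r (map noCut rest) → Closes ((q ⊮ ren σ A) ∷ Θ) →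
  (∀ {Θ'} → Θ ⊆ Θ' → Fits σ Θ' r (map (withCut A) rest) → Closes Θ') → Closes Θ
cut-everywhere A [] q≤r [] d k = k ⊆-refl []
cut-everywhere {σ} A ((n , Γ , Δ) ∷ rest) q≤r (fit r≤s h f) d k =
  cut-admissible (ren σ A) (lower-admissible (ren σ A) (≤-trans q≤r r≤s) d)
    (cut-everywhere A rest (≤-trans q≤r r≤s) (Fits-mono there f) (weaken ⊆-second d) λ s g →
      k (s ∘ there) (fit r≤s (restore s (Holds-mono (s ∘ there) h)) g))
  where
  restore : ∀ {Θ Θ' q} → (q ⊩ ren σ A) ∷ Θ ⊆ Θ' → Holds σ Θ' q (Γ ⊢ Δ) → Holds σ Θ' q (withCut A (n , Γ , Δ))
  restore s (w , l , r) = w , All.++⁺ (All.replicate⁺ n (s (here refl))) l , r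

fresh-prefix : ∀ {a} G {X} → a ∉ parsLNS (G ++ X) → a ∉ parsLNS G
fresh-prefix G a∉ m = a∉ (subst (_ ∈_) (sym (concatMap-++ parsC G _)) (∈-++⁺ˡ m))

fresh-suffix : ∀ {a} G {X} → a ∉ parsLNS (G ++ X) → a ∉ parsLNS X
fresh-suffix G a∉ m = a∉ (subst (_ ∈_) (sym (concatMap-++ parsC G _)) (∈-++⁺ʳ (parsLNS G) m))

module _ {σ : ℕ → ℕ} {Θ Φ : List Entry} {a b : ℕ} where
  Holds-fresh : ∀ {q} c → a ∉ parsC c → Holds σ Θ q c → Holds (σ ⟨ a ↦ b ⟩) (Φ ++ Θ) q c
  Holds-fresh c a∉ = Holds-map c (xs⊆ys++xs _ _) (update-agrees σ b a∉)

  Fits-fresh : ∀ {q} S → a ∉ parsLNS S → Fits σ Θ q S → Fits (σ ⟨ a ↦ b ⟩) (Φ ++ Θ) q S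
  Fits-fresh S a∉ = Fits-map (xs⊆ys++xs _ _) (update-agrees σ b a∉)

wk₂ : ∀ {x y} {Θ : List Entry} → Θ ⊆ x ∷ y ∷ Θ
wk₂ = there ∘ there

wk₃ : ∀ {x y z} {Θ : List Entry} → Θ ⊆ x ∷ y ∷ z ∷ Θ
wk₃ = there ∘ there ∘ there

-- The induction hypothesis covers every renaming and every placement. Hence an eigenvariable can be
-- sent to the parameter of any branch and an opened component to any later world, without
-- transforming the premise derivation.
sound : ∀ {c S} → Derivable c S → ∀ σ {Θ i} → Fits σ Θ i S → Closes Θ
sound (exch p d) σ f = sound d σ (Fits-exchange p f)
sound (id₁ G H Γ Δ p as) σ f
  with focused _ (fit _ (_ , l ∷ _ , r ∷ _) _) _ ← focus G f =
  by (close ≤-refl) l (λ { (here refl) → r }) λ ()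
sound (id₂ G H F Γ₁ Δ₁ Γ₂ Δ₂ p as) σ f
  with focused _ (fit _ (_ , l ∷ _ , _) g) _ ← focus G f
  with focused q≤j (fit j≤r (_ , _ , r ∷ _) _) _ ← focus H g =
  by (close (≤-trans q≤j j≤r)) l (λ { (here refl) → r }) λ ()
sound (⊥l G H Γ Δ) σ f
  with focused _ (fit _ (_ , l ∷ _ , _) _) _ ← focus G f =
  by ⊩⊥ l (λ ()) λ ()
sound (∧l G H Γ Δ A B d) σ f
  with focused _ (fit j≤q (w , p ∷ l , r) g) plug ← focus G f =
  by ⊩∧ p (λ ()) λ _ →
    sound d σ (plug wk₂ (same σ (parsLNS G))
      (fit j≤q (wk₂ w , here refl ∷ there (here refl) ∷ All.map wk₂ l , All.map wk₂ r) (Fits-mono wk₂ g)))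
sound (∨r G H Γ Δ A B d) σ f
  with focused _ (fit j≤q (w , l , p ∷ r) g) plug ← focus G f =
  by ⊮∨ p (λ ()) λ _ →
    sound d σ (plug wk₂ (same σ (parsLNS G))
      (fit j≤q (wk₂ w , All.map wk₂ l , here refl ∷ there (here refl) ∷ All.map wk₂ r) (Fits-mono wk₂ g)))
sound (∧r G H Γ Δ A B d d') σ f
  with focused _ (fit j≤q (w , l , p ∷ r) g) plug ← focus G f =
  by ⊮∧ p (λ ()) λ
    { true  → sound d σ (plug there (same σ (parsLNS G))
        (fit j≤q (there w , All.map there l , here refl ∷ All.map there r) (Fits-mono there g)))
    ; false → sound d' σ (plug there (same σ (parsLNS G))
        (fit j≤q (there w , All.map there l , here refl ∷ All.map there r) (Fits-mono there g))) }
sound (∨l G H Γ Δ A B d d') σ f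
  with focused _ (fit j≤q (w , p ∷ l , r) g) plug ← focus G f =
  by ⊩∨ p (λ ()) λ
    { true  → sound d σ (plug there (same σ (parsLNS G))
        (fit j≤q (there w , here refl ∷ All.map there l , All.map there r) (Fits-mono there g)))
    ; false → sound d' σ (plug there (same σ (parsLNS G))
        (fit j≤q (there w , here refl ∷ All.map there l , All.map there r) (Fits-mono there g))) }
sound (⊃r₁ G Γ Δ A B d) σ f
  with focused _ (fit j≤q (w , l , p ∷ r) []) plug ← focus G f =
  by ⊮⊃ p (λ ()) λ { (t , q≤t) →
    sound d σ (plug wk₃ (same σ (parsLNS G))
      (fit j≤q (wk₃ w , All.map wk₃ l , All.map wk₃ r)
      (fit q≤t (here refl , there (here refl) ∷ [] , there (there (here refl)) ∷ []) []))) }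
sound (⊃l G H Γ Δ A B d d') σ f
  with focused _ (fit j≤q (w , p ∷ l , r) g) plug ← focus G f =
  by (⊩⊃ ≤-refl) p (λ { (here refl) → w }) λ
    { true  → sound d σ (plug there (same σ (parsLNS G))
        (fit j≤q (there w , here refl ∷ All.map there l , All.map there r) (Fits-mono there g)))
    ; false → sound d' σ (plug there (same σ (parsLNS G))
        (fit j≤q (there w , there p ∷ All.map there l , here refl ∷ All.map there r) (Fits-mono there g))) }
sound (lift G H Γ₁ Δ₁ Γ₂ Δ₂ A d) σ f
  with focused _ (fit j≤q h@(_ , p ∷ _ , _) (fit q≤t (w , l , r) g)) plug ← focus G f =
  lift-admissible (ren σ A) q≤t p (sound d σ (plug there (same σ (parsLNS G))
    (fit j≤q (Holds-mono there h)
    (fit q≤t (there w , here refl ∷ All.map there l , All.map there r) (Fits-mono there g)))))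
sound (∀l G H Γ Δ x A a d) σ f
  with focused _ (fit j≤q (w , p ∷ l , r) g) plug ← focus G f =
  by (⊩∀ ≤-refl (σ a)) p (λ { (here refl) → w }) λ _ →
    sound d σ (plug there (same σ (parsLNS G))
      (fit j≤q (there w , here (cong (_ ⊩_) (ren-subst σ A a x)) ∷ there p ∷ All.map there l , All.map there r)
        (Fits-mono there g)))
sound (∃r G H Γ Δ x A a d) σ f
  with focused _ (fit j≤q (w , l , p ∷ r) g) plug ← focus G f =
  by (⊮∃ (σ a)) p (λ ()) λ _ →
    sound d σ (plug there (same σ (parsLNS G))
      (fit j≤q (there w , All.map there l , here (cong (_ ⊮_) (ren-subst σ A a x)) ∷ there p ∷ All.map there r)
        (Fits-mono there g)))
sound (∃l G H Γ Δ x A a a∉ d) σ f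
  with focused _ (fit j≤q h@(w , p ∷ l , r) g) plug ← focus G f
  with a∉G , a∉X ← fresh-prefix G a∉ , fresh-suffix G a∉ =
  by ⊩∃ p (λ ()) λ b →
    let w' , l' , r' = Holds-fresh {Φ = _ ∷ []} (∃' x A ∷ Γ ⊢ Δ) (a∉X ∘ ∈-++⁺ˡ) h in
    sound d (σ ⟨ a ↦ b ⟩) (plug there (update-agrees σ b a∉G)
      (fit j≤q (w' , here (cong (_ ⊩_) (sym (ren-instance x A (a∉X ∘ ∈-++⁺ˡ ∘ ∈-++⁺ˡ ∘ ∈-++⁺ˡ)))) ∷ All.tail l' , r')
        (Fits-fresh H (a∉X ∘ ∈-++⁺ʳ (parsC (∃' x A ∷ Γ ⊢ Δ))) g)))
sound (∀r₁ G Γ Δ x A a a∉ d) σ f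
  with focused _ (fit j≤q h@(w , l , p ∷ r) []) plug ← focus G f
  with a∉G , a∉X ← fresh-prefix G a∉ , fresh-suffix G a∉ =
  by ⊮∀ p (λ ()) λ { ((u , q≤u) , b) →
    let w' , l' , r' = Holds-fresh {Φ = _ ∷ _ ∷ []} (Γ ⊢ ∀' x A ∷ Δ) (a∉X ∘ ∈-++⁺ˡ {ys = []}) h
        a∉A = a∉X ∘ ∈-++⁺ˡ {ys = []} ∘ ∈-++⁺ʳ (concatMap pars Γ) ∘ ∈-++⁺ˡ in
    sound d (σ ⟨ a ↦ b ⟩) (plug (there ∘ there) (update-agrees σ b a∉G)
      (fit j≤q (w' , l' , All.tail r')
      (fit q≤u (here refl , [] , there (here (cong (_ ⊮_) (sym (ren-instance x A a∉A)))) ∷ []) []))) }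
sound (⊃r₂ G H Γ₁ Δ₁ Γ₂ Δ₂ A B d d') σ f
  with focused _ (fit {q} j≤q (w , l , p ∷ r) (fit {t} q≤t h@(w' , l' , r') g)) plug ← focus G f =
  by ⊮⊃ p (λ ()) λ { (u , q≤u) →
    -- The order is total: a world `u` up to `t` fits between the two components as in the first
    -- premise. Beyond `t`, the second premise closes with `t ⊮ (A ⊃' B)` added, and that entry is
    -- inverted at `u`.
    [ (λ u≤t → sound d σ (plug wk₃ (same σ (parsLNS G))
        (fit j≤q (wk₃ w , All.map wk₃ l , All.map wk₃ r)
        (fit q≤u (here refl , there (here refl) ∷ [] , there (there (here refl)) ∷ [])
        (fit u≤t (Holds-mono wk₃ h) (Fits-mono wk₃ g))))))
    , (λ t≤u → invert (λ ()) ⊮⊃ (λ { ⊮⊃ → refl }) (u , t≤u) (sound d' σ (plug there (same σ (parsLNS G))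
        (fit j≤q (there w , All.map there l , All.map there r)
        (fit q≤t (there w' , All.map there l' , here refl ∷ All.map there r') (Fits-mono there g))))))
    ]′ (≤-total u t) }
sound (∀r₂ G H Γ₁ Δ₁ Γ₂ Δ₂ x A a a∉ d d') σ f
  with focused _ (fit {q} j≤q h@(w , l , p ∷ r) (fit {t} q≤t h'@(w' , l' , r') g)) plug ← focus G f
  with a∉G , a∉X ← fresh-prefix G a∉ , fresh-suffix G a∉ =
  by ⊮∀ p (λ ()) λ { ((u , q≤u) , b) →
    let v , m , n = Holds-fresh {Φ = _ ∷ _ ∷ []} (Γ₁ ⊢ ∀' x A ∷ Δ₁) (a∉X ∘ ∈-++⁺ˡ) h
        a∉A = a∉X ∘ ∈-++⁺ˡ ∘ ∈-++⁺ʳ (concatMap pars Γ₁) ∘ ∈-++⁺ˡ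
        a∉Y = a∉X ∘ ∈-++⁺ʳ (parsC (Γ₁ ⊢ ∀' x A ∷ Δ₁)) in
    [ (λ u≤t → sound d (σ ⟨ a ↦ b ⟩) (plug (there ∘ there) (update-agrees σ b a∉G)
        (fit j≤q (v , m , All.tail n)
        (fit q≤u (here refl , [] , there (here (cong (_ ⊮_) (sym (ren-instance x A a∉A)))) ∷ [])
        (fit u≤t (Holds-fresh (Γ₂ ⊢ Δ₂) (a∉Y ∘ ∈-++⁺ˡ) h') (Fits-fresh H (a∉Y ∘ ∈-++⁺ʳ (parsC (Γ₂ ⊢ Δ₂))) g))))))
    , (λ t≤u → invert (λ ()) ⊮∀ (λ { ⊮∀ → refl }) ((u , t≤u) , b) (sound d' σ (plug there (same σ (parsLNS G))
        (fit j≤q (there w , All.map there l , All.map there r)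
        (fit q≤t (there w' , All.map there l' , here refl ∷ All.map there r') (Fits-mono there g))))))
    ]′ (≤-total u t) }
sound (cut _ G H F Γ Δ A k₁ Γ₁ Δ₁ rest _ eq eq' _ d d') σ f
  with unzipped (fit j≤q h g) pl pr ← unzip-prefix G F eq f
  with (w , l , r) , h' ← Holds-unsplice (Γ ⊢ Δ) (Γ₁ ⊢ Δ₁) h
  with gH , gF ← unzip H (map noCut rest) (trans eq' (sym (length-map noCut rest))) g =
  -- The component at the cut is the first one treated, at its own world, so its `k₁` copies are
  -- handled like those further right.
  cut-everywhere A ((k₁ , Γ₁ , Δ₁) ∷ rest) ≤-refl (fit ≤-refl h' gF)
    (sound d σ (pl there (fit j≤q (there w , All.map there l , here refl ∷ All.map there r) (Fits-mono there gH))))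
    λ s g' → sound d' σ (pr s (Fits-from j≤q g'))

-- From closed tableaux to cut-free LNIF

Labelled : Set
Labelled = List (ℚ × Component)

labels : Labelled → List ℚ
labels = map proj₁

comps : Labelled → LNS
comps = map proj₂

Sorted : Labelled → Set
Sorted T = AllPairs _<_ (labels T)

Provable : Labelled → Set
Provable T = Derivable false (comps T)

entries : ℚ → Component → List Entry
entries q (Γ ⊢ Δ) = at q ∷ map (q ⊩_) Γ ++ map (q ⊮_) Δ

flatten : Labelled → List Entry
flatten = concatMap (uncurry entries)

label : Entry → ℚ
label (at q)  = q
label (q ⊩ _) = q
label (q ⊮ _) = q

entries-mono : ∀ {q Γ Γ' Δ Δ'} → Γ ⊆ Γ' → Δ ⊆ Δ' → entries q (Γ ⊢ Δ) ⊆ entries q (Γ' ⊢ Δ')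
entries-mono s t = ∷⁺ʳ _ (++⁺ (map⁺ _ s) (map⁺ _ t))

entries-⊩ : ∀ {q r A} Γ Δ → (q ⊩ A) ∈ entries r (Γ ⊢ Δ) → q ≡ r × A ∈ Γ
entries-⊩ Γ Δ (there m) with ∈-++⁻ (map _ Γ) m
... | inj₁ n with _ , p , refl ← ∈-map⁻ _ n = refl , p
... | inj₂ n with _ , _ , () ← ∈-map⁻ _ n

entries-⊮ : ∀ {q r A} Γ Δ → (q ⊮ A) ∈ entries r (Γ ⊢ Δ) → q ≡ r × A ∈ Δ
entries-⊮ Γ Δ (there m) with ∈-++⁻ (map _ Γ) m
... | inj₁ n with _ , _ , () ← ∈-map⁻ _ n
... | inj₂ n with _ , p , refl ← ∈-map⁻ _ n = refl , p

entries-label : ∀ {r e} c → e ∈ entries r c → label e ≡ r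
entries-label _ (here refl) = refl
entries-label (Γ ⊢ Δ) (there m) with ∈-++⁻ (map _ Γ) m
... | inj₁ n with _ , _ , refl ← ∈-map⁻ _ n = refl
... | inj₂ n with _ , _ , refl ← ∈-map⁻ _ n = refl

head-⊮ : ∀ {q A} Γ Δ → (q ⊮ A) ∈ entries q (Γ ⊢ A ∷ Δ)
head-⊮ Γ Δ = there (∈-++⁺ʳ (map _ Γ) (here refl))

drop-⊩ : ∀ {q A} Γ Δ → entries q (A ∷ Γ ⊢ Δ) ⊆ (q ⊩ A) ∷ entries q (Γ ⊢ Δ)
drop-⊩ Γ Δ (here p)          = there (here p)
drop-⊩ Γ Δ (there (here p))  = here p
drop-⊩ Γ Δ (there (there m)) = there (there m)

drop-⊮ : ∀ {q A} Γ Δ → entries q (Γ ⊢ A ∷ Δ) ⊆ (q ⊮ A) ∷ entries q (Γ ⊢ Δ)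
drop-⊮ {q} Γ Δ = exchange (at q ∷ map (q ⊩_) Γ)

flatten-++ : ∀ T {U e} → e ∈ flatten (T ++ U) → e ∈ flatten T ⊎ e ∈ flatten U
flatten-++ T m = ∈-++⁻ (flatten T) (subst (_ ∈_) (concatMap-++ (uncurry entries) T _) m)

flatten-suffix : ∀ T {U} → flatten U ⊆ flatten (T ++ U)
flatten-suffix T m = subst (_ ∈_) (sym (concatMap-++ (uncurry entries) T _)) (∈-++⁺ʳ (flatten T) m)

flatten-under : ∀ {e} T {U V} → flatten U ⊆ e ∷ flatten V → flatten (T ++ U) ⊆ e ∷ flatten (T ++ V)
flatten-under []            s = s
flatten-under ((q , c) ∷ T) s = exchange (entries q c) ∘ ++⁺ʳ (entries q c) (flatten-under T s)

flatten-mono : ∀ T {U V} → flatten U ⊆ flatten V → flatten (T ++ U) ⊆ flatten (T ++ V)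
flatten-mono []            s = s
flatten-mono ((q , c) ∷ T) s = ++⁺ʳ (entries q c) (flatten-mono T s)

relabel : ∀ T {k c c'} U → Sorted (T ++ (k , c) ∷ U) → Sorted (T ++ (k , c') ∷ U)
relabel T {k} {c} {c'} U = subst (AllPairs _<_) (eq T)
  where
  eq : ∀ T → labels (T ++ (k , c) ∷ U) ≡ labels (T ++ (k , c') ∷ U)
  eq []      = refl
  eq (_ ∷ T) = cong (_ ∷_) (eq T)

unfold : ∀ T {U} → Provable (T ++ U) → Derivable false (comps T ++ comps U)
unfold T = subst (Derivable false) (map-++ proj₂ T _)

fold : ∀ T {U} → Derivable false (comps T ++ comps U) → Provable (T ++ U)
fold T = subst (Derivable false) (sym (map-++ proj₂ T _))

-- T contains the entry, or the entries into which some branch decomposes it. A ⊩ entry may occur at a smaller label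
-- and a ⊮ entry at a greater one, truth being monotone along the order.
data Real (T : Labelled) : Entry → Set where
  world    : ∀ {q} → at q ∈ flatten T → Real T (at q)
  ⊩stored  : ∀ {k q A} → k ≤ q → (k ⊩ A) ∈ flatten T → Real T (q ⊩ A)
  ⊮stored  : ∀ {k q A} → q ≤ k → (k ⊮ A) ∈ flatten T → Real T (q ⊮ A)
  ⊩both    : ∀ {q A B} → Real T (q ⊩ A) → Real T (q ⊩ B) → Real T (q ⊩ (A ∧' B))
  ⊩left    : ∀ {q A B} → Real T (q ⊩ A) → Real T (q ⊩ (A ∨' B))
  ⊩right   : ∀ {q A B} → Real T (q ⊩ B) → Real T (q ⊩ (A ∨' B))
  ⊩conseq  : ∀ {q A B} → Real T (q ⊩ B) → Real T (q ⊩ (A ⊃' B))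
  ⊩witness : ∀ {q x A} a → Real T (q ⊩ (A [ a / x ])) → Real T (q ⊩ ∃' x A)
  ⊮both    : ∀ {q A B} → Real T (q ⊮ A) → Real T (q ⊮ B) → Real T (q ⊮ (A ∨' B))
  ⊮left    : ∀ {q A B} → Real T (q ⊮ A) → Real T (q ⊮ (A ∧' B))
  ⊮right   : ∀ {q A B} → Real T (q ⊮ B) → Real T (q ⊮ (A ∧' B))
  ⊮conseq  : ∀ {q r A B} → q ≤ r → Real T (at r) → Real T (r ⊩ A) → Real T (r ⊮ B) → Real T (q ⊮ (A ⊃' B))
  ⊮witness : ∀ {q r x A} a → q ≤ r → Real T (at r) → Real T (r ⊮ (A [ a / x ])) → Real T (q ⊮ ∀' x A)

raise : ∀ {T q r A} → q ≤ r → Real T (q ⊩ A) → Real T (r ⊩ A)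
raise q≤r (⊩stored k≤q m) = ⊩stored (≤-trans k≤q q≤r) m
raise q≤r (⊩both p p')    = ⊩both (raise q≤r p) (raise q≤r p')
raise q≤r (⊩left p)       = ⊩left (raise q≤r p)
raise q≤r (⊩right p)      = ⊩right (raise q≤r p)
raise q≤r (⊩conseq p)     = ⊩conseq (raise q≤r p)
raise q≤r (⊩witness a p)  = ⊩witness a (raise q≤r p)

lower : ∀ {T q r A} → q ≤ r → Real T (r ⊮ A) → Real T (q ⊮ A)
lower q≤r (⊮stored r≤k m)      = ⊮stored (≤-trans q≤r r≤k) m
lower q≤r (⊮both p p')         = ⊮both (lower q≤r p) (lower q≤r p')
lower q≤r (⊮left p)            = ⊮left (lower q≤r p)
lower q≤r (⊮right p)           = ⊮right (lower q≤r p)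
lower q≤r (⊮conseq r≤s w p p') = ⊮conseq (≤-trans q≤r r≤s) w p p'
lower q≤r (⊮witness a r≤s w p) = ⊮witness a (≤-trans q≤r r≤s) w p

infix 4 _⇝_

_⇝_ : Labelled → Labelled → Set
T ⇝ U = ∀ {e} → Real T e → Real U e

stored : ∀ {T e} → e ∈ flatten T → Real T e
stored {e = at q}  m = world m
stored {e = q ⊩ A} m = ⊩stored ≤-refl m
stored {e = q ⊮ A} m = ⊮stored ≤-refl m

-- The recorded decomposition is kept and only its leaves are replaced; a leaf found at another
-- label is moved by `raise` or `lower`.
transfer : ∀ {T U} → (∀ {e} → e ∈ flatten T → Real U e) → T ⇝ U
transfer s (world m)             = s m
transfer s (⊩stored k≤q m)       = raise k≤q (s m)
transfer s (⊮stored q≤k m)       = lower q≤k (s m)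
transfer s (⊩both p p')          = ⊩both (transfer s p) (transfer s p')
transfer s (⊩left p)             = ⊩left (transfer s p)
transfer s (⊩right p)            = ⊩right (transfer s p)
transfer s (⊩conseq p)           = ⊩conseq (transfer s p)
transfer s (⊩witness a p)        = ⊩witness a (transfer s p)
transfer s (⊮both p p')          = ⊮both (transfer s p) (transfer s p')
transfer s (⊮left p)             = ⊮left (transfer s p)
transfer s (⊮right p)            = ⊮right (transfer s p)
transfer s (⊮conseq q≤r w p p')  = ⊮conseq q≤r (transfer s w) (transfer s p) (transfer s p')
transfer s (⊮witness a q≤r w p)  = ⊮witness a q≤r (transfer s w) (transfer s p)

widen : ∀ {T U} → flatten T ⊆ flatten U → T ⇝ U
widen s = transfer (stored ∘ s)

-- Rules such as `∧l` consume their principal formula while the tableau keeps it. The lost entry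
-- remains real through its parts in the premise.
decompose : ∀ {T U e} → flatten T ⊆ e ∷ flatten U → Real U e → T ⇝ U
decompose {T} {U} {e} s p = transfer λ m → go (s m)
  where
  go : ∀ {e'} → e' ∈ e ∷ flatten U → Real U e'
  go (here refl) = p
  go (there m)   = stored m

decompose-⊩ : ∀ T {k A Γ Γ' Δ Δ'} U → Γ ⊆ Γ' → Δ ⊆ Δ' → Real (T ++ (k , (Γ' ⊢ Δ')) ∷ U) (k ⊩ A) →
  (T ++ (k , (A ∷ Γ ⊢ Δ)) ∷ U) ⇝ (T ++ (k , (Γ' ⊢ Δ')) ∷ U)
decompose-⊩ T {Γ = Γ} {Δ = Δ} U s t = decompose
  (flatten-under T (++⁺ˡ (flatten U) (∷⁺ʳ _ (entries-mono s t) ∘ drop-⊩ Γ Δ)))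

decompose-⊮ : ∀ T {k A Γ Γ' Δ Δ'} U → Γ ⊆ Γ' → Δ ⊆ Δ' → Real (T ++ (k , (Γ' ⊢ Δ')) ∷ U) (k ⊮ A) →
  (T ++ (k , (Γ ⊢ A ∷ Δ)) ∷ U) ⇝ (T ++ (k , (Γ' ⊢ Δ')) ∷ U)
decompose-⊮ T {Γ = Γ} {Δ = Δ} U s t = decompose
  (flatten-under T (++⁺ˡ (flatten U) (∷⁺ʳ _ (entries-mono s t) ∘ drop-⊮ Γ Δ)))

stored-at : ∀ T {k c U e} → e ∈ entries k c → Real (T ++ (k , c) ∷ U) e
stored-at T m = stored (flatten-suffix T (∈-++⁺ˡ m))

-- Exchange, order of labels and insertion of components

_≋_ : Labelled → Labelled → Set
_≋_ = Pointwise λ { (q , c) (r , d) → q ≡ r × c ≈c d }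

≈c-refl : ∀ {c} → c ≈c c
≈c-refl = ↭-refl , ↭-refl

≋-refl : ∀ {T} → T ≋ T
≋-refl = Pointwise.refl (refl , ≈c-refl)

≋-labels : ∀ {T U} → T ≋ U → labels T ≡ labels U
≋-labels [] = refl
≋-labels ((refl , _) ∷ p) = cong (_ ∷_) (≋-labels p)

≋-comps : ∀ {T U} → T ≋ U → comps U ≈ comps T
≋-comps [] = []
≋-comps ((_ , p , p') ∷ ps) = (↭-sym p , ↭-sym p') ∷ ≋-comps ps

≋-flatten : ∀ {T U} → T ≋ U → flatten T ⊆ flatten U
≋-flatten [] = ⊆-refl
≋-flatten ((refl , p , p') ∷ ps) = ++⁺ (entries-mono (∈-resp-↭ p) (∈-resp-↭ p')) (≋-flatten ps)

∈⇒↭ : ∀ {A : Formula} {Γ} → A ∈ Γ → ∃ λ Γ' → Γ ↭ A ∷ Γ'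
∈⇒↭ m with Γ₁ , Γ₂ , refl ← ∈-∃++ m = Γ₁ ++ Γ₂ , shift _ Γ₁ Γ₂

front-⊩ : ∀ {k A} T → (k ⊩ A) ∈ flatten T → ∃₂ λ U V → ∃₂ λ Γ Δ → T ≋ (U ++ (k , (A ∷ Γ ⊢ Δ)) ∷ V)
front-⊩ ((r , (Γ ⊢ Δ)) ∷ T) m with ∈-++⁻ (entries r (Γ ⊢ Δ)) m
... | inj₁ n with refl , a ← entries-⊩ Γ Δ n with Γ' , p ← ∈⇒↭ a =
  [] , T , Γ' , Δ , (refl , p , ↭-refl) ∷ ≋-refl
... | inj₂ n with U , V , Γ' , Δ' , p ← front-⊩ T n =
  (r , (Γ ⊢ Δ)) ∷ U , V , Γ' , Δ' , (refl , ≈c-refl) ∷ p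

front-⊮ : ∀ {k A} T → (k ⊮ A) ∈ flatten T → ∃₂ λ U V → ∃₂ λ Γ Δ → T ≋ (U ++ (k , (Γ ⊢ A ∷ Δ)) ∷ V)
front-⊮ ((r , (Γ ⊢ Δ)) ∷ T) m with ∈-++⁻ (entries r (Γ ⊢ Δ)) m
... | inj₁ n with refl , a ← entries-⊮ Γ Δ n with Δ' , p ← ∈⇒↭ a =
  [] , T , Γ , Δ' , (refl , ↭-refl , p) ∷ ≋-refl
... | inj₂ n with U , V , Γ' , Δ' , p ← front-⊮ T n =
  (r , (Γ ⊢ Δ)) ∷ U , V , Γ' , Δ' , (refl , ≈c-refl) ∷ p

module _ {T} (so : Sorted T) where
  rearrange : ∀ {U} → T ≋ U → (Sorted U → T ⇝ U → Provable U) → Provable T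
  rearrange p k = exch (≋-comps p) (k (subst (AllPairs _<_) (≋-labels p) so) (widen (≋-flatten p)))

  -- The rules of LNIF expect the principal formula at the head of its list. The continuation
  -- receives the rearranged sequent with all it needs, so later steps do not deal with
  -- permutations.
  surface-⊩ : ∀ {k A} → (k ⊩ A) ∈ flatten T →
    (∀ U V Γ Δ → let T' = U ++ (k , (A ∷ Γ ⊢ Δ)) ∷ V in Sorted T' → T ⇝ T' → Provable T') → Provable T
  surface-⊩ m k with U , V , Γ , Δ , p ← front-⊩ T m = rearrange p (k U V Γ Δ)

  surface-⊮ : ∀ {k A} → (k ⊮ A) ∈ flatten T →
    (∀ U V Γ Δ → let T' = U ++ (k , (Γ ⊢ A ∷ Δ)) ∷ V in Sorted T' → T ⇝ T' → Provable T') → Provable T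
  surface-⊮ m k with U , V , Γ , Δ , p ← front-⊮ T m = rearrange p (k U V Γ Δ)

Sorted-before : ∀ {k c e} T {U} → Sorted (T ++ (k , c) ∷ U) → e ∈ flatten T → label e < k
Sorted-before ((r , c) ∷ T) (lt ∷ so) m with ∈-++⁻ (entries r c) m
... | inj₁ n = subst (_< _) (sym (entries-label c n))
                 (All.lookup lt (subst (_ ∈_) (sym (map-++ proj₁ T _)) (∈-++⁺ʳ (labels T) (here refl))))
... | inj₂ n = Sorted-before T so n

Sorted-after : ∀ {k c e} T {U} → Sorted (T ++ (k , c) ∷ U) → k ≤ label e →
  e ∈ flatten (T ++ (k , c) ∷ U) → e ∈ flatten ((k , c) ∷ U)
Sorted-after T so k≤ m with flatten-++ T m
... | inj₁ n = ⊥-elim (<-irrefl refl (<-≤-trans (Sorted-before T so n) k≤))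
... | inj₂ n = n

fresh : ∀ as → ∃ λ a → a ∉ as
-- No member of a list exceeds its sum.
fresh as = suc (sum as) , λ m → ℕ.<-irrefl refl (bound m)
  where
  bound : ∀ {a as} → a ∈ as → a ℕ.≤ sum as
  bound (here refl)         = ℕ.m≤m+n _ _
  bound {as = b ∷ _} (there m) = ℕ.≤-trans (bound m) (ℕ.m≤n+m _ b)

<-suc : ∀ q → q < q + 1ℚ
<-suc q = subst (_< q + 1ℚ) (+-identityʳ q) (+-monoʳ-< q (positive⁻¹ 1ℚ))

-- Density gives a label in the gap after `k`; at the right end `k + 1ℚ` does. The label is good for
-- every `d`, so the inserted component can be chosen later from the conclusion of the rule.
insert-between : ∀ T {k c} U → Sorted (T ++ (k , c) ∷ U) →
  ∃ λ q → k < q × (∀ d → Sorted (T ++ (k , c) ∷ (q , d) ∷ U))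
insert-between ((_ , _) ∷ T) {k} {c} U (lt ∷ so) with q , k<q , so' ← insert-between T U so =
  q , k<q , λ d → spread T lt ∷ so' d
  where
  spread : ∀ T {d r} → All (r <_) (labels (T ++ (k , c) ∷ U)) → All (r <_) (labels (T ++ (k , c) ∷ (q , d) ∷ U))
  spread []      (p ∷ ps) = p ∷ <-trans p k<q ∷ ps
  spread (_ ∷ T) (p ∷ ps) = p ∷ spread T ps
insert-between [] {k} [] so = k + 1ℚ , <-suc k , λ d → (<-suc k ∷ []) ∷ [] ∷ []
insert-between [] {k} ((r , _) ∷ U) ((k<r ∷ lt) ∷ lt' ∷ so) with q , k<q , q<r ← <-dense k<r =
  q , k<q , λ d → (k<q ∷ k<r ∷ lt) ∷ (q<r ∷ All.map (<-trans q<r) lt') ∷ lt' ∷ so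

Sorted-adjacent : ∀ T {k c k' c'} U → Sorted (T ++ (k , c) ∷ (k' , c') ∷ U) → k < k'
Sorted-adjacent []      U ((lt ∷ _) ∷ _) = lt
Sorted-adjacent (_ ∷ T) U (_ ∷ so)       = Sorted-adjacent T U so

Sorted-relabel₂ : ∀ T {k c d k' c' d'} U →
  Sorted (T ++ (k , c) ∷ (k' , c') ∷ U) → Sorted (T ++ (k , d) ∷ (k' , d') ∷ U)
Sorted-relabel₂ T {k} {c} {d} {k'} {c'} {d'} U = subst (AllPairs _<_) (eq T)
  where
  eq : ∀ T → labels (T ++ (k , c) ∷ (k' , c') ∷ U) ≡ labels (T ++ (k , d) ∷ (k' , d') ∷ U)
  eq []      = refl
  eq (_ ∷ T) = cong (_ ∷_) (eq T)

-- Moving formulae rightwards and opening components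

Reaches : ℚ → Formula → Labelled → Set
Reaches r A T = Sorted T →
  (∀ U V Γ Δ → let T' = U ++ (r , (A ∷ Γ ⊢ Δ)) ∷ V in Sorted T' → T ⇝ T' → Provable T') → Provable T

-- Repeated `lift` copies `A` one component to the right until the component labelled `r` is met;
-- the recursion is on the components to the right.
reach : ∀ {r A} V U {k Γ Δ} → at r ∈ flatten ((k , (A ∷ Γ ⊢ Δ)) ∷ V) → Reaches r A (U ++ (k , (A ∷ Γ ⊢ Δ)) ∷ V)
reach {r} {A} V U {k} {Γ} {Δ} m so ih with ∈-++⁻ (entries k (A ∷ Γ ⊢ Δ)) m
... | inj₁ n with refl ← entries-label (A ∷ Γ ⊢ Δ) n = ih U V Γ Δ so id
reach {r} {A} ((k' , (Γ' ⊢ Δ')) ∷ V) U {k} {Γ} {Δ} m so ih | inj₂ n =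
  fold U (lift (comps U) (comps V) Γ Δ Γ' Δ' A (unfold U
    (subst (Reaches r A) (++-assoc U _ _)
      (reach V (U ++ (k , (A ∷ Γ ⊢ Δ)) ∷ []) (++⁺ˡ (flatten V) grow n))
      (Sorted-relabel₂ U V so) λ U' V' Γ'' Δ'' so' w →
        ih U' V' Γ'' Δ'' so' (w ∘ widen (flatten-mono U
          (++⁺ʳ (entries k (A ∷ Γ ⊢ Δ)) (++⁺ˡ (flatten V) grow)))))))
  where
  grow : entries k' (Γ' ⊢ Δ') ⊆ entries k' (A ∷ Γ' ⊢ Δ')
  grow = entries-mono {Γ = Γ'} (xs⊆x∷xs _ _) ⊆-refl

-- C is A ⊃ B or ∀xA. The opened component is a function of the conclusion because of the eigenvariable of ∀xA.
record Opener (C : Formula) : Set where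
  field
    pick  : LNS → Component
    last  : ∀ G Γ Δ → let S = G ++ (Γ ⊢ C ∷ Δ) ∷ [] in
            Derivable false (G ++ (Γ ⊢ Δ) ∷ pick S ∷ []) → Derivable false S
    inner : ∀ G H Γ₁ Δ₁ Γ₂ Δ₂ → let S = G ++ (Γ₁ ⊢ C ∷ Δ₁) ∷ (Γ₂ ⊢ Δ₂) ∷ H in
            Derivable false (G ++ (Γ₁ ⊢ Δ₁) ∷ pick S ∷ (Γ₂ ⊢ Δ₂) ∷ H) →
            Derivable false (G ++ (Γ₁ ⊢ Δ₁) ∷ (Γ₂ ⊢ C ∷ Δ₂) ∷ H) → Derivable false S
    real  : ∀ {T q r} S → q ≤ r → entries r (pick S) ⊆ flatten T → Real T (q ⊮ C)

⊃-opener : ∀ A B → Opener (A ⊃' B)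
⊃-opener A B = record
  { pick  = λ _ → A ∷ [] ⊢ B ∷ []
  ; last  = λ G Γ Δ → ⊃r₁ G Γ Δ A B
  ; inner = λ G H Γ₁ Δ₁ Γ₂ Δ₂ → ⊃r₂ G H Γ₁ Δ₁ Γ₂ Δ₂ A B
  ; real  = λ S q≤r s → ⊮conseq q≤r (stored (s (here refl))) (stored (s (there (here refl))))
                          (stored (s (there (there (here refl)))))
  }

∀-opener : ∀ x A → Opener (∀' x A)
∀-opener x A = record
  { pick  = λ S → [] ⊢ (A [ proj₁ (fresh (parsLNS S)) / x ]) ∷ []
  ; last  = λ G Γ Δ → ∀r₁ G Γ Δ x A _ (proj₂ (fresh _))
  ; inner = λ G H Γ₁ Δ₁ Γ₂ Δ₂ → ∀r₂ G H Γ₁ Δ₁ Γ₂ Δ₂ x A _ (proj₂ (fresh _))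
  ; real  = λ S q≤r s → ⊮witness _ q≤r (stored (s (here refl))) (stored (s (there (here refl))))
  }

module _ {C : Formula} (opener : Opener C) where
  open Opener opener

  Opens : ℚ → Labelled → Set
  Opens k T = Sorted T →
    (∀ {q U} S → k ≤ q → Sorted U → T ⇝ U → entries q (pick S) ⊆ flatten U → Provable U) → Provable T

  -- Each gap to the right of `k` gives one branch of the derivation: the first premise of the inner
  -- rule opens a component in the current gap, the second hands `C` to the next component. The
  -- continuation must answer for all these labels, as the tableau does.
  open-at : ∀ V U {k Γ Δ} → Opens k (U ++ (k , (Γ ⊢ C ∷ Δ)) ∷ V)
  open-at V U {k} {Γ} {Δ} so ih with q , k<q , so' ← insert-between U V so = derive V so so' ih
    where
    opened : ∀ V S → Labelled
    opened V S = U ++ (k , (Γ ⊢ Δ)) ∷ (q , pick S) ∷ V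

    member : ∀ V S → entries q (pick S) ⊆ flatten (opened V S)
    member V S m = flatten-suffix U (∈-++⁺ʳ (entries k (Γ ⊢ Δ)) (∈-++⁺ˡ m))

    first : ∀ V S → (U ++ (k , (Γ ⊢ C ∷ Δ)) ∷ V) ⇝ opened V S
    first V S = decompose (flatten-under U (++⁺ (drop-⊮ Γ Δ) (xs⊆ys++xs (flatten V) (entries q (pick S)))))
      (real S (<⇒≤ k<q) (member V S))

    derive : ∀ V → let T = U ++ (k , (Γ ⊢ C ∷ Δ)) ∷ V in
      Sorted T → (∀ d → Sorted (U ++ (k , (Γ ⊢ C ∷ Δ)) ∷ (q , d) ∷ V)) →
      (∀ {q U} S → k ≤ q → Sorted U → T ⇝ U → entries q (pick S) ⊆ flatten U → Provable U) → Provable T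
    derive [] so so' ih = fold U (last (comps U) Γ Δ
      (unfold U (ih _ (<⇒≤ k<q) (relabel U _ (so' _)) (first [] _) (member [] _))))
    derive ((k' , (Γ' ⊢ Δ')) ∷ V) so so' ih = fold U (inner (comps U) (comps V) Γ Δ Γ' Δ'
      (unfold U (ih _ (<⇒≤ k<q) (relabel U _ (so' _)) (first (_ ∷ V) _) (member (_ ∷ V) _)))
      (unfold U (subst (Opens k') (++-assoc U _ _) (open-at V (U ++ (k , (Γ ⊢ Δ)) ∷ []))
        (Sorted-relabel₂ U V so) λ S k'≤r so'' w → ih S (≤-trans k≤k' k'≤r) so'' (w ∘ second))))
      where
      k≤k' : k ≤ k'
      k≤k' = <⇒≤ (Sorted-adjacent U V so)
      -- Moving `C` to `k'` loses nothing, since `k ⊮ C` is real as soon as `k' ⊮ C` is stored.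
      second : (U ++ (k , (Γ ⊢ C ∷ Δ)) ∷ (k' , (Γ' ⊢ Δ')) ∷ V) ⇝ (U ++ (k , (Γ ⊢ Δ)) ∷ (k' , (Γ' ⊢ C ∷ Δ')) ∷ V)
      second = decompose
        (flatten-under U (++⁺ (drop-⊮ Γ Δ) (++⁺ˡ (flatten V) (entries-mono {Γ = Γ'} ⊆-refl (xs⊆x∷xs _ _)))))
        (⊮stored k≤k' (flatten-suffix U (∈-++⁺ʳ (entries k (Γ ⊢ Δ)) (∈-++⁺ˡ (head-⊮ Γ' Δ')))))

add-⊩ : ∀ T {k A Γ Δ} U → (T ++ (k , (Γ ⊢ Δ)) ∷ U) ⇝ (T ++ (k , (A ∷ Γ ⊢ Δ)) ∷ U)
add-⊩ T {Γ = Γ} U = widen (flatten-mono T (++⁺ˡ (flatten U) (entries-mono {Γ = Γ} (xs⊆x∷xs _ _) ⊆-refl)))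

add-⊮ : ∀ T {k A Γ Δ} U → (T ++ (k , (Γ ⊢ Δ)) ∷ U) ⇝ (T ++ (k , (Γ ⊢ A ∷ Δ)) ∷ U)
add-⊮ T {Γ = Γ} U = widen (flatten-mono T (++⁺ˡ (flatten U) (entries-mono {Γ = Γ} ⊆-refl (xs⊆x∷xs _ _))))

-- A stored entry is decomposed by the matching LNIF rule. An entry decomposed earlier needs no
-- rule: its record names the branch of the tableau to follow, including its world and parameter.
-- Repeated use of one entry is thereby absorbed.
step : ∀ {T e} (ρ : Rule e) → Sorted T → Real T e → (∀ {e'} → e' ∈ side ρ → Real T e') →
  (∀ b {U} → Sorted U → T ⇝ U → All (Real U) (new ρ b) → Provable U) → Provable T

step (close {p = p} {ts} q≤r) so (⊩stored {k} k≤q m) sd ih = surface-⊩ so m λ U V Γ Δ so' w →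
  axiom U V Γ Δ so' (w (sd (here refl)))
  where
  axiom : ∀ U V Γ Δ → let T' = U ++ (k , (atom p ts ∷ Γ ⊢ Δ)) ∷ V in
    Sorted T' → Real T' (_ ⊮ atom p ts) → Provable T'
  -- An atom has no decomposition, so the side entry is stored, at a label not before `k`: `id₁`
  -- applies in the same component, `id₂` in a later one.
  axiom U V Γ Δ so' (⊮stored r≤k' m')
    with ∈-++⁻ (entries k (atom p ts ∷ Γ ⊢ Δ)) (Sorted-after U so' (≤-trans k≤q (≤-trans q≤r r≤k')) m')
  ... | inj₁ n with _ , a ← entries-⊮ (atom p ts ∷ Γ) Δ n with Δ' , π ← ∈⇒↭ a =
    exch (≋-comps (Pointwise.++⁺ ≋-refl ((refl , ↭-refl , π) ∷ ≋-refl)))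
      (fold U (id₁ (comps U) (comps V) Γ Δ' p ts))
  ... | inj₂ n with V₁ , V₂ , Γ' , Δ' , π ← front-⊮ V n =
    exch (≋-comps (Pointwise.++⁺ (≋-refl {U}) ((refl , ≈c-refl) ∷ π)))
      (fold U (subst (λ S → Derivable false (comps U ++ (atom p ts ∷ Γ ⊢ Δ) ∷ S)) (sym (map-++ proj₂ V₁ _))
        (id₂ (comps U) (comps V₁) (comps V₂) Γ Δ Γ' Δ' p ts)))

step ⊩⊥ so (⊩stored _ m) sd ih = surface-⊩ so m λ U V Γ Δ _ _ → fold U (⊥l (comps U) (comps V) Γ Δ)

step ⊩∧ so (⊩both p p') sd ih = ih tt so id (p ∷ p' ∷ [])
step ⊩∧ so (⊩stored k≤q m) sd ih = surface-⊩ so m λ U V Γ Δ so' w →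
  let a = stored-at U (there (here refl)) ; b = stored-at U (there (there (here refl))) in
  fold U (∧l (comps U) (comps V) Γ Δ _ _ (unfold U
    (ih tt (relabel U V so') (decompose-⊩ U V (there ∘ there) ⊆-refl (⊩both a b) ∘ w)
      (raise k≤q a ∷ raise k≤q b ∷ []))))

step ⊮∨ so (⊮both p p') sd ih = ih tt so id (p ∷ p' ∷ [])
step ⊮∨ so (⊮stored q≤k m) sd ih = surface-⊮ so m λ U V Γ Δ so' w →
  let a = stored-at U (head-⊮ Γ _) ; b = stored-at U (entries-mono {Γ = Γ} ⊆-refl there (head-⊮ Γ Δ)) in
  fold U (∨r (comps U) (comps V) Γ Δ _ _ (unfold U
    (ih tt (relabel U V so') (decompose-⊮ U V ⊆-refl (there ∘ there) (⊮both a b) ∘ w)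
      (lower q≤k a ∷ lower q≤k b ∷ []))))

step ⊮∧ so (⊮left p) sd ih = ih true so id (p ∷ [])
step ⊮∧ so (⊮right p) sd ih = ih false so id (p ∷ [])
step ⊮∧ so (⊮stored q≤k m) sd ih = surface-⊮ so m λ U V Γ Δ so' w →
  fold U (∧r (comps U) (comps V) Γ Δ _ _
    (unfold U (let a = stored-at U (head-⊮ Γ Δ) in
      ih true (relabel U V so') (decompose-⊮ U V ⊆-refl there (⊮left a) ∘ w) (lower q≤k a ∷ [])))
    (unfold U (let a = stored-at U (head-⊮ Γ Δ) in
      ih false (relabel U V so') (decompose-⊮ U V ⊆-refl there (⊮right a) ∘ w) (lower q≤k a ∷ []))))

step ⊩∨ so (⊩left p) sd ih = ih true so id (p ∷ [])
step ⊩∨ so (⊩right p) sd ih = ih false so id (p ∷ [])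
step ⊩∨ so (⊩stored k≤q m) sd ih = surface-⊩ so m λ U V Γ Δ so' w →
  fold U (∨l (comps U) (comps V) Γ Δ _ _
    (unfold U (let a = stored-at U (there (here refl)) in
      ih true (relabel U V so') (decompose-⊩ U V there ⊆-refl (⊩left a) ∘ w) (raise k≤q a ∷ [])))
    (unfold U (let a = stored-at U (there (here refl)) in
      ih false (relabel U V so') (decompose-⊩ U V there ⊆-refl (⊩right a) ∘ w) (raise k≤q a ∷ []))))

step (⊩⊃ q≤r) so (⊩conseq p) sd ih = ih true so id (raise q≤r p ∷ [])
step (⊩⊃ {r = r} {A} {B} q≤r) so (⊩stored k≤q m) sd ih = surface-⊩ so m λ U V Γ Δ so' w →
  reach V U (Sorted-after U so' (≤-trans k≤q q≤r) (position (w (sd (here refl))))) so' λ U' V' Γ' Δ' so'' w' →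
    let b = stored-at U' (there (here refl)) in
    fold U' (⊃l (comps U') (comps V') Γ' Δ' A B
      -- The first premise of `⊃l` drops the implication, which stays real through `B`; the second
      -- premise keeps it.
      (unfold U' (ih true (relabel U' V' so'') (decompose-⊩ U' V' there ⊆-refl (⊩conseq b) ∘ w' ∘ w) (b ∷ [])))
      (unfold U' (ih false (relabel U' V' so'') (add-⊮ U' V' ∘ w' ∘ w) (stored-at U' (head-⊮ (_ ∷ Γ') Δ') ∷ []))))
  where
  position : ∀ {T q} → Real T (at q) → at q ∈ flatten T
  position (world m) = m

-- An instance true at `k` is true at `r`, so the formula is used where it stands. An implication
-- has to be carried to `r`, since refuting its antecedent at `k` says nothing about `r`.
step (⊩∀ q≤r a) so (⊩stored k≤q m) sd ih = surface-⊩ so m λ U V Γ Δ so' w →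
  fold U (∀l (comps U) (comps V) Γ Δ _ _ a (unfold U
    (ih tt (relabel U V so') (add-⊩ U V ∘ w) (raise (≤-trans k≤q q≤r) (stored-at U (there (here refl))) ∷ []))))

step (⊮∃ a) so (⊮stored q≤k m) sd ih = surface-⊮ so m λ U V Γ Δ so' w →
  fold U (∃r (comps U) (comps V) Γ Δ _ _ a (unfold U
    (ih tt (relabel U V so') (add-⊮ U V ∘ w) (lower q≤k (stored-at U (head-⊮ Γ _)) ∷ []))))

step ⊩∃ so (⊩witness a p) sd ih = ih a so id (p ∷ [])
step ⊩∃ so (⊩stored k≤q m) sd ih = surface-⊩ so m λ U V Γ Δ so' w →
  let a , a∉ = fresh _ ; b = stored-at U (there (here refl)) in
  fold U (∃l (comps U) (comps V) Γ Δ _ _ a a∉ (unfold U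
    (ih a (relabel U V so') (decompose-⊩ U V there ⊆-refl (⊩witness a b) ∘ w) (raise k≤q b ∷ []))))

step ⊮⊃ so (⊮conseq q≤r w p p') sd ih = ih (_ , q≤r) so id (w ∷ p ∷ p' ∷ [])
step ⊮⊃ so (⊮stored {A = A ⊃' B} q≤k m) sd ih = surface-⊮ so m λ U V Γ Δ so' w →
  open-at (⊃-opener A B) V U so' λ S k≤r so'' w' s → ih (_ , ≤-trans q≤k k≤r) so'' (w' ∘ w)
    (stored (s (here refl)) ∷ stored (s (there (here refl))) ∷ stored (s (there (there (here refl)))) ∷ [])

step ⊮∀ so (⊮witness a q≤r w p) sd ih = ih ((_ , q≤r) , a) so id (w ∷ p ∷ [])
step ⊮∀ so (⊮stored {A = ∀' x A} q≤k m) sd ih = surface-⊮ so m λ U V Γ Δ so' w →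
  open-at (∀-opener x A) V U so' λ S k≤r so'' w' s →
    ih ((_ , ≤-trans q≤k k≤r) , proj₁ (fresh (parsLNS S))) so'' (w' ∘ w)
    (stored (s (here refl)) ∷ stored (s (there (here refl))) ∷ [])

-- The invariant asks only that every tableau entry be real in `T`; `T` may discard principal
-- formulae while `Θ` keeps growing.
complete : ∀ {Θ T} → Closes Θ → Sorted T → (∀ {e} → e ∈ Θ → Real T e) → Provable T
complete (by ρ m s k) so R = step ρ so (R m) (R ∘ s) λ b so' w n →
  complete (k b) so' (λ m' → [ All.lookup n , w ∘ R ]′ (∈-++⁻ (new ρ b) m'))

-- Initial labels and the conclusion

number : ℚ → LNS → Labelled
number q []      = []
number q (c ∷ S) = (q , c) ∷ number (q + 1ℚ) S

comps-number : ∀ q S → comps (number q S) ≡ S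
comps-number q []      = refl
comps-number q (c ∷ S) = cong (c ∷_) (comps-number (q + 1ℚ) S)

Sorted-number : ∀ q S → Sorted (number q S)
Sorted-number q []      = []
Sorted-number q (c ∷ S) = above (<-suc q) S ∷ Sorted-number (q + 1ℚ) S
  where
  above : ∀ {r} → q < r → ∀ S → All (q <_) (labels (number r S))
  above q<r []      = []
  above q<r (_ ∷ S) = q<r ∷ above (<-trans q<r (<-suc _)) S

Fits-number : ∀ q S → Fits id (flatten (number q S)) q S
Fits-number q []            = []
Fits-number q ((Γ ⊢ Δ) ∷ S) = fit ≤-refl
  (here refl
  , All.tabulate (λ m → subst (λ A → (q ⊩ A) ∈ _) (sym (ren-id _)) (∈-++⁺ˡ (there (∈-++⁺ˡ (∈-map⁺ _ m)))))
  , All.tabulate (λ m → subst (λ A → (q ⊮ A) ∈ _) (sym (ren-id _))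
      (∈-++⁺ˡ (there (∈-++⁺ʳ (map _ Γ) (∈-map⁺ _ m))))))
  (Fits-from (<⇒≤ (<-suc q)) (Fits-mono (xs⊆ys++xs _ (entries q (Γ ⊢ Δ))) (Fits-number (q + 1ℚ) S)))

theorem4 : ∀ (S : LNS) → ClosedLNS S → Derivable true S → Derivable false S
theorem4 S _ d = subst (Derivable false) (comps-number 0ℚ S)
  (complete (sound d _ (Fits-number 0ℚ S)) (Sorted-number 0ℚ S) stored)
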